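{- Let $\beta$ be a Salem number with minimal polynomial $P(x) = x^6 + ax^5 + bx^4 + cx^3 + bx^2 + ax + 1$, where $a,b,c\in\mathbb{Z}$. Then $\beta \in P_{1,7} \cap C_{x^2+2x+1}$ (that is, $d_\beta(1)$ is eventually periodic with preperiod length $1$ and period length $7$, and the co-factor of $\beta$ is $x^2+2x+1$) if and only if all of the following hold: (i) $a \leq -4$; (ii) $2 - 2a \leq 2b \leq -3a - 2$; (iii) $a - 2b + 2 \leq 2c \leq -2a - 4b$.
   Context: A Salem number is a real algebraic integer $\beta>1$ whose other Galois conjugates all satisfy $|\alpha|\le 1$, with at least one satisfying $|\alpha|=1$. For real $\beta>1$, the greedy beta expansion $d_\beta(1)=(c_n)_{n\ge1}$ is defined by $r_0=1$, and for $n\ge 1$: $c_n=\lfloor \beta r_{n-1}\rfloor$, $r_n=\beta r_{n-1}-\lfloor \beta r_{n-1}\rfloor$. If it is eventually periodic, $\beta$ is called a Parry number, and the smallest $m\ge0$ and $p\ge1$ with $c_{n+m}=c_{n+m+p}$ for all $n\ge1$ are the preperiod length and the period length of the expansion. (By convention $p=0$ if $r_N=0$ for some $N$; this never happens for Salem numbers.) For a Salem number $\beta$ that is a Parry number with preperiod length $m$ and period length $p\geq 1$, put $P_k(x)=x^k-c_1x^{k-1}-\dots-c_k$. The companion polynomial is $R(x)=P_{m+p}(x)-P_m(x)$; it has $\beta$ as a root, so $R(x)=P(x)Q(x)$ with $P$ the minimal polynomial of $\beta$ and $Q\in\mathbb{Z}[x]$; $Q$ is the co-factor of $\beta$. $P_{m,p}$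 denotes the set of Salem Parry numbers whose beta expansion $d_\beta(1)$ has preperiod length $m$ and period length $p$. $C_{Q(x)}$ denotes the set of all Salem (Parry) numbers whose co-factor is $Q(x)$. -}

module Defs where

open import Algebra.Bundles.Raw using (RawRing)
open import Data.Integer.Base as ℤ using (ℤ; +_)
open import Data.List.Base using (List; []; _∷_; map; foldr)
open import Data.Nat.Base as ℕ using (ℕ; zero; suc)
import Data.Nat.Properties as ℕₚ
open import Data.Product.Base using (_×_; _,_; ∃-syntax)
open import Data.Rational.Base
  using (ℚ; 0ℚ; 1ℚ; ½; _+_; _*_; _-_; -_; _≤_; _<_; ∣_∣; _/_; 1/_; Positive; positive)
import Data.Rational.Base as ℚ
import Data.Rational.Properties as ℚₚ
open import Data.Rational.Solver using (module +-*-Solver)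
open import Function.Base using (_∘_)
open import Level using (0ℓ)
open import Relation.Binary.PropositionalEquality
  using (_≡_; refl; sym; trans; cong; cong₂; subst)
open import Relation.Nullary.Negation using (¬_)
open import Relation.Unary using (Pred)

open +-*-Solver using (solve; _:=_; _:+_; _:*_; _:-_; :-_; con)

-- Real numbers: Cauchy sequences of rationals, considered up to _≈ℝ_.

IsCauchy : (ℕ → ℚ) → Set
IsCauchy x =
  ∀ ε → 0ℚ < ε → ∃[ N ] ∀ m n → N ℕ.≤ m → N ℕ.≤ n → ∣ x m - x n ∣ ≤ ε

record ℝ : Set where
  constructor mkℝ
  field
    seq    : ℕ → ℚ
    cauchy : IsCauchy seq

open ℝ public

infix 4 _≈ℝ_ _<ℝ_ _≤ℝ_

_≈ℝ_ : ℝ → ℝ → Set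
x ≈ℝ y = ∀ ε → 0ℚ < ε → ∃[ N ] ∀ n → N ℕ.≤ n → ∣ seq x n - seq y n ∣ ≤ ε

_<ℝ_ : ℝ → ℝ → Set
x <ℝ y = ∃[ ε ] 0ℚ < ε × ∃[ N ] ∀ n → N ℕ.≤ n → seq x n + ε ≤ seq y n

_≤ℝ_ : ℝ → ℝ → Set
x ≤ℝ y = ∀ ε → 0ℚ < ε → ∃[ N ] ∀ n → N ℕ.≤ n → seq x n ≤ seq y n + ε

fromℚ : ℚ → ℝ
fromℚ q = mkℝ (λ _ → q) λ ε 0<ε → 0 , λ _ _ _ _ →
  subst (λ d → ∣ d ∣ ≤ ε) (sym (ℚₚ.+-inverseʳ q)) (ℚₚ.<⇒≤ 0<ε)

fromℤ : ℤ → ℝ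
fromℤ z = fromℚ (z / 1)

0ℝ 1ℝ : ℝ
0ℝ = fromℚ 0ℚ
1ℝ = fromℚ 1ℚ

abstract
  0<½* : ∀ {ε} → 0ℚ < ε → 0ℚ < ½ * ε
  0<½* {ε} 0<ε = ℚₚ.positive⁻¹ (½ * ε) {{ℚₚ.pos*pos⇒pos ½ ε {{positive 0<ε}}}}

  +-cauchy : ∀ x y → IsCauchy x → IsCauchy y → IsCauchy (λ n → x n + y n)
  +-cauchy x y cx cy ε 0<ε
    with M , hx ← cx (½ * ε) (0<½* 0<ε)
       | N , hy ← cy (½ * ε) (0<½* 0<ε)
    = M ℕ.⊔ N , λ m n p q → begin
      ∣ (x m + y m) - (x n + y n) ∣
        ≡⟨ cong ∣_∣ (solve 4 (λ a b c d → (a :+ b) :- (c :+ d) := (a :- c) :+ (b :- d))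
             refl (x m) (y m) (x n) (y n)) ⟩
      ∣ (x m - x n) + (y m - y n) ∣
        ≤⟨ ℚₚ.∣p+q∣≤∣p∣+∣q∣ (x m - x n) (y m - y n) ⟩
      ∣ x m - x n ∣ + ∣ y m - y n ∣
        ≤⟨ ℚₚ.+-mono-≤
             (hx m n (ℕₚ.m⊔n≤o⇒m≤o M N p) (ℕₚ.m⊔n≤o⇒m≤o M N q))
             (hy m n (ℕₚ.m⊔n≤o⇒n≤o M N p) (ℕₚ.m⊔n≤o⇒n≤o M N q)) ⟩
      ½ * ε + ½ * ε
        ≡⟨ solve 1 (λ e → con ½ :* e :+ con ½ :* e := e) refl ε ⟩
      ε ∎
    where open ℚₚ.≤-Reasoning

  neg-cauchy : ∀ x → IsCauchy x → IsCauchy (λ n → - x n)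
  neg-cauchy x cx ε 0<ε with N , h ← cx ε 0<ε = N , λ m n p q → begin
      ∣ - x m - - x n ∣
        ≡⟨ cong ∣_∣ (solve 2 (λ a b → :- a :- (:- b) := b :- a) refl (x m) (x n)) ⟩
      ∣ x n - x m ∣  ≤⟨ h n m q p ⟩
      ε ∎
    where open ℚₚ.≤-Reasoning

  bounded : ∀ x → IsCauchy x →
            ∃[ B ] 0ℚ < B × ∃[ N ] ∀ n → N ℕ.≤ n → ∣ x n ∣ ≤ B
  bounded x cx with N , h ← cx 1ℚ (ℚₚ.positive⁻¹ 1ℚ) =
    1ℚ + ∣ x N ∣ ,
    ℚₚ.+-mono-<-≤ (ℚₚ.positive⁻¹ 1ℚ) (ℚₚ.0≤∣p∣ (x N)) ,
    N , λ n p → begin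
      ∣ x n ∣
        ≡⟨ cong ∣_∣ (solve 2 (λ a b → a := (a :- b) :+ b) refl (x n) (x N)) ⟩
      ∣ (x n - x N) + x N ∣    ≤⟨ ℚₚ.∣p+q∣≤∣p∣+∣q∣ (x n - x N) (x N) ⟩
      ∣ x n - x N ∣ + ∣ x N ∣  ≤⟨ ℚₚ.+-monoˡ-≤ ∣ x N ∣ (h n N p ℕₚ.≤-refl) ⟩
      1ℚ + ∣ x N ∣ ∎
    where open ℚₚ.≤-Reasoning

  *-mono-≤ : ∀ {p q r s} → 0ℚ ≤ q → 0ℚ ≤ r → p ≤ q → r ≤ s → p * r ≤ q * s
  *-mono-≤ {q = q} {r = r} 0≤q 0≤r p≤q r≤s = ℚₚ.≤-trans
    (ℚₚ.*-monoʳ-≤-nonNeg r {{ℚ.nonNegative 0≤r}} p≤q)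
    (ℚₚ.*-monoˡ-≤-nonNeg q {{ℚ.nonNegative 0≤q}} r≤s)

  *-close : ∀ a b c d A B δ → 0ℚ ≤ A → 0ℚ ≤ δ →
            ∣ a ∣ ≤ A → ∣ d ∣ ≤ B → ∣ a - c ∣ ≤ δ → ∣ b - d ∣ ≤ δ →
            ∣ a * b - c * d ∣ ≤ δ * (A + B)
  *-close a b c d A B δ 0≤A 0≤δ a≤A d≤B ac bd = begin
      ∣ a * b - c * d ∣
        ≡⟨ cong ∣_∣ (solve 4 (λ a b c d →
             a :* b :- c :* d := a :* (b :- d) :+ (a :- c) :* d) refl a b c d) ⟩
      ∣ a * (b - d) + (a - c) * d ∣
        ≤⟨ ℚₚ.∣p+q∣≤∣p∣+∣q∣ (a * (b - d)) ((a - c) * d) ⟩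
      ∣ a * (b - d) ∣ + ∣ (a - c) * d ∣
        ≡⟨ cong₂ _+_ (ℚₚ.∣p*q∣≡∣p∣*∣q∣ a (b - d)) (ℚₚ.∣p*q∣≡∣p∣*∣q∣ (a - c) d) ⟩
      ∣ a ∣ * ∣ b - d ∣ + ∣ a - c ∣ * ∣ d ∣
        ≤⟨ ℚₚ.+-mono-≤ (*-mono-≤ 0≤A (ℚₚ.0≤∣p∣ (b - d)) a≤A bd)
                       (*-mono-≤ 0≤δ (ℚₚ.0≤∣p∣ d) ac d≤B) ⟩
      A * δ + δ * B
        ≡⟨ solve 3 (λ A B δ → A :* δ :+ δ :* B := δ :* (A :+ B)) refl A B δ ⟩
      δ * (A + B) ∎
    where open ℚₚ.≤-Reasoning

  divide : ∀ ε C → 0ℚ < ε → 0ℚ < C → ∃[ δ ] 0ℚ < δ × δ * C ≡ ε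
  divide ε C 0<ε 0<C = ε * 1/ C ,
      ℚₚ.positive⁻¹ (ε * 1/ C)
        {{ℚₚ.pos*pos⇒pos ε {{positive 0<ε}} (1/ C) {{ℚₚ.1/pos⇒pos C}}}} ,
      trans (ℚₚ.*-assoc ε (1/ C) C)
        (trans (cong (ε *_) (ℚₚ.*-inverseˡ C)) (ℚₚ.*-identityʳ ε))
    where
    instance
      C-pos : Positive C
      C-pos = positive 0<C
      C-nonZero : ℚ.NonZero C
      C-nonZero = ℚₚ.pos⇒nonZero C

  *-cauchy : ∀ x y → IsCauchy x → IsCauchy y → IsCauchy (λ n → x n * y n)
  *-cauchy x y cx cy ε 0<ε =
    let A , 0<A , K , hA = bounded x cx
        B , 0<B , L , hB = bounded y cy
        δ , 0<δ , δC≡ε   = divide ε (A + B) 0<ε (ℚₚ.+-mono-< 0<A 0<B)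
        M , hx = cx δ 0<δ
        N , hy = cy δ 0<δ
    in M ℕ.⊔ N ℕ.⊔ (K ℕ.⊔ L) , λ m n p q →
      let p₁ = ℕₚ.m⊔n≤o⇒m≤o (M ℕ.⊔ N) (K ℕ.⊔ L) p
          q₁ = ℕₚ.m⊔n≤o⇒m≤o (M ℕ.⊔ N) (K ℕ.⊔ L) q
          p₂ = ℕₚ.m⊔n≤o⇒n≤o (M ℕ.⊔ N) (K ℕ.⊔ L) p
          q₂ = ℕₚ.m⊔n≤o⇒n≤o (M ℕ.⊔ N) (K ℕ.⊔ L) q
      in subst (∣ x m * y m - x n * y n ∣ ≤_) δC≡ε
           (*-close (x m) (y m) (x n) (y n) A B δ (ℚₚ.<⇒≤ 0<A) (ℚₚ.<⇒≤ 0<δ)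
             (hA m (ℕₚ.m⊔n≤o⇒m≤o K L p₂))
             (hB n (ℕₚ.m⊔n≤o⇒n≤o K L q₂))
             (hx m n (ℕₚ.m⊔n≤o⇒m≤o M N p₁) (ℕₚ.m⊔n≤o⇒m≤o M N q₁))
             (hy m n (ℕₚ.m⊔n≤o⇒n≤o M N p₁) (ℕₚ.m⊔n≤o⇒n≤o M N q₁)))

infixl 6 _+ℝ_ _-ℝ_
infixl 7 _*ℝ_
infix  8 -ℝ_

_+ℝ_ _*ℝ_ : ℝ → ℝ → ℝ
x +ℝ y = mkℝ (λ n → seq x n + seq y n) (+-cauchy (seq x) (seq y) (cauchy x) (cauchy y))
x *ℝ y = mkℝ (λ n → seq x n * seq y n) (*-cauchy (seq x) (seq y) (cauchy x) (cauchy y))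

-ℝ_ : ℝ → ℝ
-ℝ x = mkℝ (λ n → - seq x n) (neg-cauchy (seq x) (cauchy x))

_-ℝ_ : ℝ → ℝ → ℝ
x -ℝ y = x +ℝ (-ℝ y)

ℝ-rawRing : RawRing 0ℓ 0ℓ
ℝ-rawRing = record
  { Carrier = ℝ ; _≈_ = _≈ℝ_ ; _+_ = _+ℝ_ ; _*_ = _*ℝ_ ; -_ = -ℝ_ ; 0# = 0ℝ ; 1# = 1ℝ }

record ℂ : Set where
  constructor _+i_
  field
    re im : ℝ

open ℂ public

infix 4 _≈ℂ_

_≈ℂ_ : ℂ → ℂ → Set
z ≈ℂ w = re z ≈ℝ re w × im z ≈ℝ im w

ℝ→ℂ : ℝ → ℂ
ℝ→ℂ x = x +i 0ℝ

ℂ-rawRing : RawRing 0ℓ 0ℓ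
ℂ-rawRing = record
  { Carrier = ℂ
  ; _≈_ = _≈ℂ_
  ; _+_ = λ z w → (re z +ℝ re w) +i (im z +ℝ im w)
  ; _*_ = λ z w → (re z *ℝ re w -ℝ im z *ℝ im w) +i (re z *ℝ im w +ℝ im z *ℝ re w)
  ; -_  = λ z → (-ℝ re z) +i (-ℝ im z)
  ; 0#  = ℝ→ℂ 0ℝ
  ; 1#  = ℝ→ℂ 1ℝ
  }

IsModulus : ℂ → ℝ → Set
IsModulus z ρ = 0ℝ ≤ℝ ρ × ρ *ℝ ρ ≈ℝ re z *ℝ re z +ℝ im z *ℝ im z

-- A polynomial is the list of its coefficients in ascending order of degree,
-- trailing zeros allowed; hence equality is coefficientwise (_≈ₚ_).

module Polynomial (K : RawRing 0ℓ 0ℓ) where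
  private module K = RawRing K

  Poly : Set
  Poly = List K.Carrier

  coeff : Poly → ℕ → K.Carrier
  coeff []      _       = K.0#
  coeff (a ∷ _) zero    = a
  coeff (_ ∷ p) (suc n) = coeff p n

  infix  4 _≈ₚ_
  infixl 6 _+ₚ_ _-ₚ_
  infixl 7 _*ₚ_

  _≈ₚ_ : Poly → Poly → Set
  p ≈ₚ q = ∀ n → coeff p n K.≈ coeff q n

  _+ₚ_ _-ₚ_ _*ₚ_ : Poly → Poly → Poly
  []      +ₚ q       = q
  (a ∷ p) +ₚ []      = a ∷ p
  (a ∷ p) +ₚ (b ∷ q) = (a K.+ b) ∷ (p +ₚ q)

  p -ₚ q = p +ₚ map K.-_ q

  []      *ₚ q = []
  (a ∷ p) *ₚ q = map (a K.*_) q +ₚ (K.0# ∷ (p *ₚ q))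

  HasDegree : Poly → ℕ → Set
  HasDegree p d = ¬ (coeff p d K.≈ K.0#) × (∀ n → d ℕ.< n → coeff p n K.≈ K.0#)

  Monic : Poly → ℕ → Set
  Monic p d = coeff p d K.≈ K.1# × (∀ n → d ℕ.< n → coeff p n K.≈ K.0#)

module ℤ[x] = Polynomial ℤ.+-*-rawRing
module ℚ[x] = Polynomial ℚ.+-*-rawRing

module _ (S : RawRing 0ℓ 0ℓ) where
  private module S = RawRing S

  eval : {A : Set} → (A → S.Carrier) → List A → S.Carrier → S.Carrier
  eval ι p x = foldr (λ a v → ι a S.+ x S.* v) S.0# p

evalℝ : ℚ[x].Poly → ℝ → ℝ
evalℝ = eval ℝ-rawRing fromℚ

evalℂ : ℚ[x].Poly → ℂ → ℂ
evalℂ = eval ℂ-rawRing (ℝ→ℂ ∘ fromℚ)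

ℤ→ℚ[x] : ℤ[x].Poly → ℚ[x].Poly
ℤ→ℚ[x] = map (_/ 1)

IsMinimalPolynomial : ℝ → ℚ[x].Poly → Set
IsMinimalPolynomial β p = ∃[ d ]
  ℚ[x].Monic p d × evalℝ p β ≈ℝ 0ℝ ×
  (∀ q e → ℚ[x].HasDegree q e → evalℝ q β ≈ℝ 0ℝ → d ℕ.≤ e)

IsAlgebraicInteger : ℝ → Set
IsAlgebraicInteger β = ∃[ p ] ∃[ d ] ℤ[x].Monic p d × evalℝ (ℤ→ℚ[x] p) β ≈ℝ 0ℝ

IsConjugate : ℝ → ℂ → Set
IsConjugate β α = ∃[ p ] IsMinimalPolynomial β p × evalℂ p α ≈ℂ ℝ→ℂ 0ℝ

OtherConjugate : ℝ → ℂ → Set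
OtherConjugate β α = IsConjugate β α × ¬ (α ≈ℂ ℝ→ℂ β)

record IsSalem (β : ℝ) : Set where
  field
    1<β              : 1ℝ <ℝ β
    algebraicInteger : IsAlgebraicInteger β
    inUnitDisk       : ∀ α → OtherConjugate β α → ∃[ ρ ] IsModulus α ρ × ρ ≤ℝ 1ℝ
    onUnitCircle     : ∃[ α ] OtherConjugate β α × IsModulus α 1ℝ

-- The floor of a real number is not a computable function, so it is a relation.

IsFloor : ℝ → ℤ → Set
IsFloor x k = fromℤ k ≤ℝ x × x <ℝ fromℤ (k ℤ.+ + 1)

-- Digits are indexed from 1, as in d_β(1) = c₁c₂c₃…; the value c 0 is irrelevant.

record IsBetaExpansion (β : ℝ) (c : ℕ → ℤ) (r : ℕ → ℝ) : Set where
  field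
    r₀        : r 0 ≈ℝ 1ℝ
    digit     : ∀ n → IsFloor (β *ℝ r n) (c (suc n))
    remainder : ∀ n → r (suc n) ≈ℝ β *ℝ r n -ℝ fromℤ (c (suc n))

PeriodicFrom : (ℕ → ℤ) → ℕ → ℕ → Set
PeriodicFrom c m p = ∀ n → 1 ℕ.≤ n → c (n ℕ.+ m) ≡ c (n ℕ.+ m ℕ.+ p)

-- An expansion with some zero remainder has period length 0 by convention, so
-- having a period length p ≥ 1 entails that no remainder vanishes.

record HasPreperiodPeriod (β : ℝ) (m p : ℕ) (c : ℕ → ℤ) : Set where
  field
    remainders  : ℕ → ℝ
    expansion   : IsBetaExpansion β c remainders
    nonzero     : ∀ n → ¬ (remainders n ≈ℝ 0ℝ)
    1≤p         : 1 ℕ.≤ p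
    periodic    : PeriodicFrom c m p
    minimal     : ∀ m′ p′ → 1 ℕ.≤ p′ → PeriodicFrom c m′ p′ → m ℕ.≤ m′ × p ℕ.≤ p′

𝒫 : ℕ → ℕ → Pred ℝ 0ℓ
𝒫 m p β = IsSalem β × ∃[ c ] HasPreperiodPeriod β m p c

-- Pₖ(x) = xᵏ - c₁xᵏ⁻¹ - … - cₖ, built from Pₖ₊₁(x) = x Pₖ(x) - cₖ₊₁.

digitPoly : (ℕ → ℤ) → ℕ → ℤ[x].Poly
digitPoly c zero    = + 1 ∷ []
digitPoly c (suc k) = ℤ.- c (suc k) ∷ digitPoly c k

companion : (ℕ → ℤ) → ℕ → ℕ → ℤ[x].Poly
companion c m p = digitPoly c (m ℕ.+ p) ℤ[x].-ₚ digitPoly c m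

IsCofactor : ℝ → ℤ[x].Poly → Set
IsCofactor β q = ∃[ m ] ∃[ p ] ∃[ c ] HasPreperiodPeriod β m p c ×
  ∃[ μ ] IsMinimalPolynomial β (ℤ→ℚ[x] μ) × companion c m p ℤ[x].≈ₚ μ ℤ[x].*ₚ q

𝒞 : ℤ[x].Poly → Pred ℝ 0ℓ
𝒞 q β = IsSalem β × IsCofactor β q

{-# OPTIONS --safe #-}
module Submission where

open import Defs
open import Data.Integer.Base using (ℤ; +_; -_; _+_; _-_; _*_; _≤_)
open import Data.List.Base using ([]; _∷_)
open import Data.Product.Base using (_×_)
open import Function.Bundles using (_⇔_)
open import Relation.Unary using (_∈_; _∩_)

open import Algebra.Bundles.Raw using (RawRing)
open import Data.Empty using (⊥-elim)
import Data.Integer.Base as ℤ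
import Data.Integer.Properties as ℤₚ
open import Data.Integer.Tactic.RingSolver using (solve-∀)
open import Data.List.Base using (map)
open import Data.Nat.Base as ℕ using (ℕ; zero; suc)
import Data.Nat.Properties as ℕₚ
open import Data.Product.Base using (_,_; ∃-syntax; proj₁; proj₂)
open import Data.Rational.Base as ℚ using (ℚ; 0ℚ; 1ℚ; ½; ∣_∣)
import Data.Rational.Properties as ℚₚ
open import Data.Rational.Solver using (module +-*-Solver)
open import Data.Rational.Unnormalised.Base as ℚᵘ using (mkℚᵘ)
import Data.Rational.Unnormalised.Properties as ℚᵘₚ
open import Data.Sum.Base using (_⊎_; inj₁; inj₂)
open import Function.Bundles using (mk⇔)
open import Level using (0ℓ)
open import Relation.Binary.Definitions using (tri<; tri≈; tri>)
open import Relation.Binary.PropositionalEquality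
  using (_≡_; refl; sym; trans; cong; cong₂; subst; subst₂; module ≡-Reasoning)
open import Relation.Nullary using (¬_; yes; no)

open +-*-Solver using (solve; _:=_; _:+_; _:*_; _:-_; :-_; con)

-- Comparing P₈ − P₁ with P (x + 1)² forces the digits c₁ (c₂ c₃ c₄ c₃ c₂ c₁−1 c₁−1)^ω with
-- c₁ = −a−2, c₂ = −b−2a−1, c₃ = −a−2b−c, c₄ = −2b−2c, and then the conditions say exactly
-- that c₂ ≤ c₁, 0 ≤ c₃ and c₄ ≤ c₁. These inequalities hold for every greedy expansion of this
-- shape. Conversely, they give c₃ < c₂ and c₁ ≥ 2, so every shift of the word is
-- lexicographically smaller than the word itself. The remainders rₙ computed from these digits
-- satisfy r₈ = r₁ because P(β) = 0, and following the lexicographic comparison around the cycle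
-- of remainders gives 0 < rₙ < 1, so the digits are the greedy ones. Minimality of the
-- period holds because 7 is prime and c₂ ≠ c₃.

-- The embedding of ℤ in ℚ

ι : ℤ → ℚ
ι z = z ℚ./ 1

-- Division by 1 goes through normalisation and does not compute on a variable `z`, so facts about
-- `ι` are checked on the unnormalised fraction with denominator 1.
toℚᵘ-ι : ∀ z → ℚ.toℚᵘ (ι z) ℚᵘ.≃ mkℚᵘ z 0
toℚᵘ-ι z = ℚₚ.toℚᵘ-fromℚᵘ (mkℚᵘ z 0)

ι-+ : ∀ x y → ι (x + y) ≡ ι x ℚ.+ ι y
ι-+ x y = ℚₚ.toℚᵘ-injective (begin
  ℚ.toℚᵘ (ι (x + y))                      ≈⟨ toℚᵘ-ι (x + y) ⟩
  mkℚᵘ (x + y) 0                          ≈⟨ ℚᵘ.*≡* (cong₂ (λ u v → (u + v) * + 1)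
                                               (sym (ℤₚ.*-identityʳ x)) (sym (ℤₚ.*-identityʳ y))) ⟩
  mkℚᵘ x 0 ℚᵘ.+ mkℚᵘ y 0                  ≈⟨ ℚᵘₚ.+-cong (toℚᵘ-ι x) (toℚᵘ-ι y) ⟨
  ℚ.toℚᵘ (ι x) ℚᵘ.+ ℚ.toℚᵘ (ι y)          ≈⟨ ℚₚ.toℚᵘ-homo-+ (ι x) (ι y) ⟨
  ℚ.toℚᵘ (ι x ℚ.+ ι y)                    ∎)
  where open ℚᵘₚ.≃-Reasoning

ι-neg : ∀ x → ι (- x) ≡ ℚ.- ι x
ι-neg x = begin
  ι (- x)                          ≡⟨ solve 2 (λ u v → u := (v :+ u) :- v) refl (ι (- x)) (ι x) ⟩
  (ι x ℚ.+ ι (- x)) ℚ.- ι x        ≡⟨ cong (ℚ._- ι x) (ι-+ x (- x)) ⟨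
  ι (x + - x) ℚ.- ι x              ≡⟨ cong (λ z → ι z ℚ.- ι x) (ℤₚ.+-inverseʳ x) ⟩
  0ℚ ℚ.- ι x                       ≡⟨ ℚₚ.+-identityˡ (ℚ.- ι x) ⟩
  ℚ.- ι x                          ∎
  where open ≡-Reasoning

ι-mono-≤ : ∀ {x y} → x ≤ y → ι x ℚ.≤ ι y
ι-mono-≤ {x} {y} x≤y = ℚₚ.toℚᵘ-cancel-≤
  (ℚᵘₚ.≤-respˡ-≃ (ℚᵘₚ.≃-sym (toℚᵘ-ι x)) (ℚᵘₚ.≤-respʳ-≃ (ℚᵘₚ.≃-sym (toℚᵘ-ι y))
    (ℚᵘ.*≤* (ℤₚ.*-monoʳ-≤-nonNeg (+ 1) x≤y))))

ι-cancel-< : ∀ {x y} → ι x ℚ.< ι y → x ℤ.< y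
ι-cancel-< {x} {y} p = ℤₚ.≰⇒> (λ y≤x → ℚₚ.<-irrefl refl (ℚₚ.<-≤-trans p (ι-mono-≤ y≤x)))

ι-injective : ∀ {x y} → ι x ≡ ι y → x ≡ y
ι-injective {x} {y} p = ℤₚ.≤-antisym (cancel-≤ x y (ℚₚ.≤-reflexive p))
                                     (cancel-≤ y x (ℚₚ.≤-reflexive (sym p)))
  where
  cancel-≤ : ∀ x y → ι x ℚ.≤ ι y → x ≤ y
  cancel-≤ x y p = subst₂ _≤_ (ℤₚ.*-identityʳ x) (ℤₚ.*-identityʳ y)
    (ℚᵘₚ.drop-*≤* (ℚᵘₚ.≤-respˡ-≃ (toℚᵘ-ι x) (ℚᵘₚ.≤-respʳ-≃ (toℚᵘ-ι y) (ℚₚ.toℚᵘ-mono-≤ p))))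

-- Order and arithmetic of Cauchy reals

p≤∣p∣ : ∀ p → p ℚ.≤ ∣ p ∣
p≤∣p∣ p with ℚₚ.∣p∣≡p∨∣p∣≡-p p
... | inj₁ eq = ℚₚ.≤-reflexive (sym eq)
... | inj₂ eq = ℚₚ.≤-trans p≤0 (ℚₚ.0≤∣p∣ p)
  where
  p≤0 : p ℚ.≤ 0ℚ
  p≤0 = subst (ℚ._≤ 0ℚ) (trans (cong ℚ.-_ eq) (solve 1 (λ p → :- (:- p) := p) refl p))
          (ℚₚ.neg-antimono-≤ (ℚₚ.0≤∣p∣ p))

∣p-q∣≡∣q-p∣ : ∀ p q → ∣ p ℚ.- q ∣ ≡ ∣ q ℚ.- p ∣
∣p-q∣≡∣q-p∣ p q = trans (sym (ℚₚ.∣-p∣≡∣p∣ (p ℚ.- q)))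
  (cong ∣_∣ (solve 2 (λ p q → :- (p :- q) := q :- p) refl p q))

0<p*q : ∀ {p q} → 0ℚ ℚ.< p → 0ℚ ℚ.< q → 0ℚ ℚ.< p ℚ.* q
0<p*q {p} {q} 0<p 0<q =
  ℚₚ.positive⁻¹ (p ℚ.* q) {{ℚₚ.pos*pos⇒pos p {{ℚ.positive 0<p}} q {{ℚ.positive 0<q}}}}

½+½ : ∀ p q → p ℚ.+ ½ ℚ.* q ℚ.+ ½ ℚ.* q ≡ p ℚ.+ q
½+½ = solve 2 (λ p q → p :+ con ½ :* q :+ con ½ :* q := p :+ q) refl

≡⇒≈ : ∀ {x y} → (∀ n → seq x n ≡ seq y n) → x ≈ℝ y
≡⇒≈ {x} {y} eq ε 0<ε = 0 , λ n _ → subst (ℚ._≤ ε)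
  (cong ∣_∣ (sym (trans (cong (ℚ._- seq y n) (eq n)) (ℚₚ.+-inverseʳ (seq y n))))) (ℚₚ.<⇒≤ 0<ε)

≈-refl : ∀ {x} → x ≈ℝ x
≈-refl {x} = ≡⇒≈ {x} {x} (λ _ → refl)

≈-sym : ∀ {x y} → x ≈ℝ y → y ≈ℝ x
≈-sym {x} {y} x≈y ε 0<ε with N , h ← x≈y ε 0<ε =
  N , λ n N≤n → subst (ℚ._≤ ε) (∣p-q∣≡∣q-p∣ (seq x n) (seq y n)) (h n N≤n)

≈-trans : ∀ {x y z} → x ≈ℝ y → y ≈ℝ z → x ≈ℝ z
≈-trans {x} {y} {z} x≈y y≈z ε 0<ε
  with M , f ← x≈y (½ ℚ.* ε) (0<½* 0<ε) | N , g ← y≈z (½ ℚ.* ε) (0<½* 0<ε)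
  = M ℕ.⊔ N , λ n p → begin
    ∣ seq x n ℚ.- seq z n ∣
      ≡⟨ cong ∣_∣ (solve 3 (λ x y z → x :- z := (x :- y) :+ (y :- z)) refl
           (seq x n) (seq y n) (seq z n)) ⟩
    ∣ (seq x n ℚ.- seq y n) ℚ.+ (seq y n ℚ.- seq z n) ∣
      ≤⟨ ℚₚ.∣p+q∣≤∣p∣+∣q∣ (seq x n ℚ.- seq y n) (seq y n ℚ.- seq z n) ⟩
    ∣ seq x n ℚ.- seq y n ∣ ℚ.+ ∣ seq y n ℚ.- seq z n ∣
      ≤⟨ ℚₚ.+-mono-≤ (f n (ℕₚ.m⊔n≤o⇒m≤o M N p)) (g n (ℕₚ.m⊔n≤o⇒n≤o M N p)) ⟩
    ½ ℚ.* ε ℚ.+ ½ ℚ.* ε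
      ≡⟨ solve 1 (λ e → con ½ :* e :+ con ½ :* e := e) refl ε ⟩
    ε ∎
  where open ℚₚ.≤-Reasoning

pointwise-≤ : ∀ {x y} → (∀ n → seq x n ℚ.≤ seq y n) → x ≤ℝ y
pointwise-≤ {x} {y} h ε 0<ε = 0 , λ n _ → begin
    seq x n           ≤⟨ h n ⟩
    seq y n           ≡⟨ ℚₚ.+-identityʳ (seq y n) ⟨
    seq y n ℚ.+ 0ℚ    ≤⟨ ℚₚ.+-monoʳ-≤ (seq y n) (ℚₚ.<⇒≤ 0<ε) ⟩
    seq y n ℚ.+ ε     ∎
  where open ℚₚ.≤-Reasoning

≈⇒≤ : ∀ {x y} → x ≈ℝ y → x ≤ℝ y
≈⇒≤ {x} {y} x≈y ε 0<ε with N , h ← x≈y ε 0<ε = N , λ n N≤n → begin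
    seq x n
      ≡⟨ solve 2 (λ x y → x := y :+ (x :- y)) refl (seq x n) (seq y n) ⟩
    seq y n ℚ.+ (seq x n ℚ.- seq y n)
      ≤⟨ ℚₚ.+-monoʳ-≤ (seq y n) (ℚₚ.≤-trans (p≤∣p∣ (seq x n ℚ.- seq y n)) (h n N≤n)) ⟩
    seq y n ℚ.+ ε ∎
  where open ℚₚ.≤-Reasoning

≤-trans : ∀ {x y z} → x ≤ℝ y → y ≤ℝ z → x ≤ℝ z
≤-trans {x} {y} {z} x≤y y≤z ε 0<ε
  with M , f ← x≤y (½ ℚ.* ε) (0<½* 0<ε) | N , g ← y≤z (½ ℚ.* ε) (0<½* 0<ε)
  = M ℕ.⊔ N , λ n p → begin
    seq x n                           ≤⟨ f n (ℕₚ.m⊔n≤o⇒m≤o M N p) ⟩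
    seq y n ℚ.+ ½ ℚ.* ε               ≤⟨ ℚₚ.+-monoˡ-≤ (½ ℚ.* ε) (g n (ℕₚ.m⊔n≤o⇒n≤o M N p)) ⟩
    seq z n ℚ.+ ½ ℚ.* ε ℚ.+ ½ ℚ.* ε   ≡⟨ ½+½ (seq z n) ε ⟩
    seq z n ℚ.+ ε                     ∎
  where open ℚₚ.≤-Reasoning

cancel-½ : ∀ p ε q → p ℚ.+ ε ℚ.≤ q ℚ.+ ½ ℚ.* ε → p ℚ.+ ½ ℚ.* ε ℚ.≤ q
cancel-½ p ε q h = subst₂ ℚ._≤_
  (solve 2 (λ p e → p :+ e :- con ½ :* e := p :+ con ½ :* e) refl p ε)
  (solve 2 (λ q e → q :+ con ½ :* e :- con ½ :* e := q) refl q ε)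
  (ℚₚ.+-monoˡ-≤ (ℚ.- (½ ℚ.* ε)) h)

<-≤-trans : ∀ {x y z} → x <ℝ y → y ≤ℝ z → x <ℝ z
<-≤-trans {x} {y} {z} (ε , 0<ε , M , f) y≤z with N , g ← y≤z (½ ℚ.* ε) (0<½* 0<ε) =
  ½ ℚ.* ε , 0<½* 0<ε , M ℕ.⊔ N , λ n p → cancel-½ (seq x n) ε (seq z n)
    (ℚₚ.≤-trans (f n (ℕₚ.m⊔n≤o⇒m≤o M N p)) (g n (ℕₚ.m⊔n≤o⇒n≤o M N p)))

≤-<-trans : ∀ {x y z} → x ≤ℝ y → y <ℝ z → x <ℝ z
≤-<-trans {x} {y} {z} x≤y (ε , 0<ε , M , f) with N , g ← x≤y (½ ℚ.* ε) (0<½* 0<ε) =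
  ½ ℚ.* ε , 0<½* 0<ε , M ℕ.⊔ N , λ n p → begin
    seq x n ℚ.+ ½ ℚ.* ε               ≤⟨ ℚₚ.+-monoˡ-≤ (½ ℚ.* ε) (g n (ℕₚ.m⊔n≤o⇒n≤o M N p)) ⟩
    seq y n ℚ.+ ½ ℚ.* ε ℚ.+ ½ ℚ.* ε   ≡⟨ ½+½ (seq y n) ε ⟩
    seq y n ℚ.+ ε                     ≤⟨ f n (ℕₚ.m⊔n≤o⇒m≤o M N p) ⟩
    seq z n                           ∎
  where open ℚₚ.≤-Reasoning

<⇒≤ : ∀ {x y} → x <ℝ y → x ≤ℝ y
<⇒≤ {x} {y} (ε , 0<ε , M , f) δ 0<δ = M , λ n p → begin
    seq x n          ≡⟨ ℚₚ.+-identityʳ (seq x n) ⟨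
    seq x n ℚ.+ 0ℚ   ≤⟨ ℚₚ.+-monoʳ-≤ (seq x n) (ℚₚ.<⇒≤ 0<ε) ⟩
    seq x n ℚ.+ ε    ≤⟨ f n p ⟩
    seq y n          ≡⟨ ℚₚ.+-identityʳ (seq y n) ⟨
    seq y n ℚ.+ 0ℚ   ≤⟨ ℚₚ.+-monoʳ-≤ (seq y n) (ℚₚ.<⇒≤ 0<δ) ⟩
    seq y n ℚ.+ δ    ∎
  where open ℚₚ.≤-Reasoning

<-trans : ∀ {x y z} → x <ℝ y → y <ℝ z → x <ℝ z
<-trans {x} {y} {z} x<y y<z = <-≤-trans {x} {y} {z} x<y (<⇒≤ {y} {z} y<z)

fromℚ-cancel-< : ∀ {p q} → fromℚ p <ℝ fromℚ q → p ℚ.< q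
fromℚ-cancel-< {p} (ε , 0<ε , N , h) =
  ℚₚ.<-≤-trans (subst (ℚ._< p ℚ.+ ε) (ℚₚ.+-identityʳ p) (ℚₚ.+-monoʳ-< p 0<ε)) (h N ℕₚ.≤-refl)

0<⇒≉0 : ∀ {x} → 0ℝ <ℝ x → ¬ (x ≈ℝ 0ℝ)
0<⇒≉0 {x} 0<x x≈0 =
  ℚₚ.<-irrefl refl (fromℚ-cancel-< (<-≤-trans {0ℝ} {x} {0ℝ} 0<x (≈⇒≤ {x} {0ℝ} x≈0)))

-- Adding one quantity to both sides preserves the order. With the hypothesis phrased through
-- differences, every rearrangement of an inequality becomes a pointwise ring identity.
≤-shift : ∀ {x y x′ y′} → (∀ n → seq x′ n ℚ.- seq x n ≡ seq y′ n ℚ.- seq y n) →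
          x ≤ℝ y → x′ ≤ℝ y′
≤-shift {x} {y} {x′} {y′} eq x≤y ε 0<ε with N , h ← x≤y ε 0<ε = N , λ n p → begin
    seq x′ n
      ≡⟨ solve 2 (λ x x′ → x′ := x :+ (x′ :- x)) refl (seq x n) (seq x′ n) ⟩
    seq x n ℚ.+ (seq x′ n ℚ.- seq x n)
      ≤⟨ ℚₚ.+-mono-≤ (h n p) (ℚₚ.≤-reflexive (eq n)) ⟩
    seq y n ℚ.+ ε ℚ.+ (seq y′ n ℚ.- seq y n)
      ≡⟨ solve 3 (λ y y′ e → y :+ e :+ (y′ :- y) := y′ :+ e) refl (seq y n) (seq y′ n) ε ⟩
    seq y′ n ℚ.+ ε ∎
  where open ℚₚ.≤-Reasoning

<-shift : ∀ {x y x′ y′} → (∀ n → seq x′ n ℚ.- seq x n ≡ seq y′ n ℚ.- seq y n) →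
          x <ℝ y → x′ <ℝ y′
<-shift {x} {y} {x′} {y′} eq (ε , 0<ε , N , h) = ε , 0<ε , N , λ n p → begin
    seq x′ n ℚ.+ ε
      ≡⟨ solve 3 (λ x x′ e → x′ :+ e := (x :+ e) :+ (x′ :- x)) refl (seq x n) (seq x′ n) ε ⟩
    (seq x n ℚ.+ ε) ℚ.+ (seq x′ n ℚ.- seq x n)
      ≤⟨ ℚₚ.+-mono-≤ (h n p) (ℚₚ.≤-reflexive (eq n)) ⟩
    seq y n ℚ.+ (seq y′ n ℚ.- seq y n)
      ≡⟨ solve 2 (λ y y′ → y :+ (y′ :- y) := y′) refl (seq y n) (seq y′ n) ⟩
    seq y′ n ∎
  where open ℚₚ.≤-Reasoning

-ℝ-congʳ : ∀ {x y} z → x ≈ℝ y → x -ℝ z ≈ℝ y -ℝ z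
-ℝ-congʳ {x} {y} z x≈y ε 0<ε with N , h ← x≈y ε 0<ε = N , λ n p → subst (ℚ._≤ ε)
  (cong ∣_∣ (solve 3 (λ x y z → x :- y := (x :- z) :- (y :- z)) refl (seq x n) (seq y n) (seq z n)))
  (h n p)

*-congˡ : ∀ x {y z} → y ≈ℝ z → x *ℝ y ≈ℝ x *ℝ z
*-congˡ x {y} {z} y≈z ε 0<ε =
  let B , 0<B , M , f = bounded (seq x) (cauchy x)
      δ , 0<δ , δB≡ε  = divide ε B 0<ε 0<B
      N , g           = y≈z δ 0<δ
  in M ℕ.⊔ N , λ n p → begin
    ∣ seq x n ℚ.* seq y n ℚ.- seq x n ℚ.* seq z n ∣
      ≡⟨ cong ∣_∣ (solve 3 (λ x y z → x :* y :- x :* z := (y :- z) :* x) refl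
           (seq x n) (seq y n) (seq z n)) ⟩
    ∣ (seq y n ℚ.- seq z n) ℚ.* seq x n ∣
      ≡⟨ ℚₚ.∣p*q∣≡∣p∣*∣q∣ (seq y n ℚ.- seq z n) (seq x n) ⟩
    ∣ seq y n ℚ.- seq z n ∣ ℚ.* ∣ seq x n ∣
      ≤⟨ *-mono-≤ (ℚₚ.<⇒≤ 0<δ) (ℚₚ.0≤∣p∣ (seq x n))
           (g n (ℕₚ.m⊔n≤o⇒n≤o M N p)) (f n (ℕₚ.m⊔n≤o⇒m≤o M N p)) ⟩
    δ ℚ.* B
      ≡⟨ δB≡ε ⟩
    ε ∎
  where open ℚₚ.≤-Reasoning

0<-seq : ∀ {x} ε n → 0ℚ ℚ.< ε → 0ℚ ℚ.+ ε ℚ.≤ seq x n → 0ℚ ℚ.< seq x n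
0<-seq {x} ε n 0<ε h = ℚₚ.<-≤-trans 0<ε (subst (ℚ._≤ seq x n) (ℚₚ.+-identityˡ ε) h)

*-monoˡ-< : ∀ w {x y} → 0ℝ <ℝ w → x <ℝ y → w *ℝ x <ℝ w *ℝ y
*-monoˡ-< w {x} {y} (δ , 0<δ , M , f) (ε , 0<ε , N , g) =
  δ ℚ.* ε , 0<p*q 0<δ 0<ε , M ℕ.⊔ N , λ n p →
    let δ≤w = subst (ℚ._≤ seq w n) (ℚₚ.+-identityˡ δ) (f n (ℕₚ.m⊔n≤o⇒m≤o M N p))
        0<w = ℚₚ.<-≤-trans 0<δ δ≤w
    in begin
    seq w n ℚ.* seq x n ℚ.+ δ ℚ.* ε
      ≤⟨ ℚₚ.+-monoʳ-≤ (seq w n ℚ.* seq x n)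
           (ℚₚ.*-monoʳ-≤-nonNeg ε {{ℚ.nonNegative (ℚₚ.<⇒≤ 0<ε)}} δ≤w) ⟩
    seq w n ℚ.* seq x n ℚ.+ seq w n ℚ.* ε
      ≡⟨ ℚₚ.*-distribˡ-+ (seq w n) (seq x n) ε ⟨
    seq w n ℚ.* (seq x n ℚ.+ ε)
      ≤⟨ ℚₚ.*-monoˡ-≤-nonNeg (seq w n) {{ℚ.nonNegative (ℚₚ.<⇒≤ 0<w)}}
           (g n (ℕₚ.m⊔n≤o⇒n≤o M N p)) ⟩
    seq w n ℚ.* seq y n ∎
  where open ℚₚ.≤-Reasoning

-- The slack in `x ≤ℝ y` gets multiplied by `w`, so it is taken as ε / B, where B eventually bounds
-- `w`.
*-monoˡ-≤ : ∀ w {x y} → 0ℝ <ℝ w → x ≤ℝ y → w *ℝ x ≤ℝ w *ℝ y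
*-monoˡ-≤ w {x} {y} (η , 0<η , L , e) x≤y ε 0<ε =
  let B , 0<B , M , f = bounded (seq w) (cauchy w)
      δ , 0<δ , δB≡ε  = divide ε B 0<ε 0<B
      N , g           = x≤y δ 0<δ
  in L ℕ.⊔ (M ℕ.⊔ N) , λ n p →
    let q   = ℕₚ.m⊔n≤o⇒n≤o L (M ℕ.⊔ N) p
        0<w = 0<-seq {w} η n 0<η (e n (ℕₚ.m⊔n≤o⇒m≤o L (M ℕ.⊔ N) p))
        w≤B = ℚₚ.≤-trans (p≤∣p∣ (seq w n)) (f n (ℕₚ.m⊔n≤o⇒m≤o M N q))
    in begin
    seq w n ℚ.* seq x n
      ≤⟨ ℚₚ.*-monoˡ-≤-nonNeg (seq w n) {{ℚ.nonNegative (ℚₚ.<⇒≤ 0<w)}}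
           (g n (ℕₚ.m⊔n≤o⇒n≤o M N q)) ⟩
    seq w n ℚ.* (seq y n ℚ.+ δ)
      ≡⟨ solve 3 (λ w y d → w :* (y :+ d) := w :* y :+ d :* w) refl (seq w n) (seq y n) δ ⟩
    seq w n ℚ.* seq y n ℚ.+ δ ℚ.* seq w n
      ≤⟨ ℚₚ.+-monoʳ-≤ (seq w n ℚ.* seq y n)
           (ℚₚ.*-monoˡ-≤-nonNeg δ {{ℚ.nonNegative (ℚₚ.<⇒≤ 0<δ)}} w≤B) ⟩
    seq w n ℚ.* seq y n ℚ.+ δ ℚ.* B
      ≡⟨ cong (seq w n ℚ.* seq y n ℚ.+_) δB≡ε ⟩
    seq w n ℚ.* seq y n ℚ.+ ε ∎
  where open ℚₚ.≤-Reasoning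

-- With B an eventual bound of `w`, an eventual lower bound ε of the product gives the lower bound ε
-- / B of `x`.
*-cancelˡ-0< : ∀ w {x} → 0ℝ <ℝ w → 0ℝ <ℝ w *ℝ x → 0ℝ <ℝ x
*-cancelˡ-0< w {x} (η , 0<η , L , e) (ε , 0<ε , N , g) =
  let B , 0<B , M , f = bounded (seq w) (cauchy w)
      δ , 0<δ , δB≡ε  = divide ε B 0<ε 0<B
  in δ , 0<δ , L ℕ.⊔ (M ℕ.⊔ N) , λ n p →
    let q    = ℕₚ.m⊔n≤o⇒n≤o L (M ℕ.⊔ N) p
        0<w  = 0<-seq {w} η n 0<η (e n (ℕₚ.m⊔n≤o⇒m≤o L (M ℕ.⊔ N) p))
        w≤B  = ℚₚ.≤-trans (p≤∣p∣ (seq w n)) (f n (ℕₚ.m⊔n≤o⇒m≤o M N q))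
    in ℚₚ.≤-trans (ℚₚ.≤-reflexive (ℚₚ.+-identityˡ δ))
      (ℚₚ.*-cancelˡ-≤-pos (seq w n) {{ℚ.positive 0<w}} (begin
        seq w n ℚ.* δ         ≡⟨ ℚₚ.*-comm (seq w n) δ ⟩
        δ ℚ.* seq w n         ≤⟨ ℚₚ.*-monoˡ-≤-nonNeg δ {{ℚ.nonNegative (ℚₚ.<⇒≤ 0<δ)}} w≤B ⟩
        δ ℚ.* B               ≡⟨ δB≡ε ⟩
        ε                     ≡⟨ ℚₚ.+-identityˡ ε ⟨
        0ℚ ℚ.+ ε              ≤⟨ g n (ℕₚ.m⊔n≤o⇒n≤o M N q) ⟩
        seq w n ℚ.* seq x n   ∎))
  where open ℚₚ.≤-Reasoning

0ℝ<1ℝ : 0ℝ <ℝ 1ℝ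
0ℝ<1ℝ = 1ℚ , ℚₚ.positive⁻¹ 1ℚ , 0 , λ _ _ → ℚₚ.≤-refl

≤-resp-≈ : ∀ {x x′ y y′} → x ≈ℝ x′ → y ≈ℝ y′ → x ≤ℝ y → x′ ≤ℝ y′
≤-resp-≈ {x} {x′} {y} {y′} x≈x′ y≈y′ x≤y =
  ≤-trans {x′} {x} {y′} (≈⇒≤ {x′} {x} (≈-sym {x} {x′} x≈x′))
    (≤-trans {x} {y} {y′} x≤y (≈⇒≤ {y} {y′} y≈y′))

<-resp-≈ : ∀ {x x′ y y′} → x ≈ℝ x′ → y ≈ℝ y′ → x <ℝ y → x′ <ℝ y′
<-resp-≈ {x} {x′} {y} {y′} x≈x′ y≈y′ x<y =
  ≤-<-trans {x′} {x} {y′} (≈⇒≤ {x′} {x} (≈-sym {x} {x′} x≈x′))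
    (<-≤-trans {x} {y} {y′} x<y (≈⇒≤ {y} {y′} y≈y′))

-- A strict inequality needs one fixed rational gap. A gap varying with the index suffices if it is
-- itself a positive real, since it then eventually exceeds a fixed positive rational.
<-by-positive : ∀ p {x y} → 0ℝ <ℝ p → (∀ n → seq x n ℚ.+ seq p n ℚ.≤ seq y n) → x <ℝ y
<-by-positive p {x} {y} 0<p h = <-≤-trans {x} {x +ℝ p} {y}
  (<-shift {0ℝ} {p} {x} {x +ℝ p}
    (λ n → solve 2 (λ x p → x :- con 0ℚ := x :+ p :- p) refl (seq x n) (seq p n)) 0<p)
  (pointwise-≤ {x +ℝ p} {y} h)

-- Domination up to a factor larger than 1. A cycle with a strict step forces
-- positivity, because w x > x with w > 1 means (w − 1) x > 0.

infix 4 _⊵_ _⊳_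

_⊵_ _⊳_ : ℝ → ℝ → Set
x ⊵ y = ∃[ w ] 1ℝ <ℝ w × y ≤ℝ w *ℝ x
x ⊳ y = ∃[ w ] 1ℝ <ℝ w × y <ℝ w *ℝ x

0<1< : ∀ w → 1ℝ <ℝ w → 0ℝ <ℝ w
0<1< w = <-trans {0ℝ} {1ℝ} {w} 0ℝ<1ℝ

1<* : ∀ v w → 1ℝ <ℝ v → 1ℝ <ℝ w → 1ℝ <ℝ v *ℝ w
1<* v w 1<v 1<w = <-trans {1ℝ} {v} {v *ℝ w} 1<v
  (<-resp-≈ {v *ℝ 1ℝ} {v} {v *ℝ w} {v *ℝ w}
    (≡⇒≈ {v *ℝ 1ℝ} {v} (λ n → ℚₚ.*-identityʳ (seq v n))) (≈-refl {v *ℝ w})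
    (*-monoˡ-< v {1ℝ} {w} (0<1< v 1<v) 1<w))

*-assoc-≈ : ∀ x y z → x *ℝ (y *ℝ z) ≈ℝ x *ℝ y *ℝ z
*-assoc-≈ x y z = ≡⇒≈ {x *ℝ (y *ℝ z)} {x *ℝ y *ℝ z}
  (λ n → sym (ℚₚ.*-assoc (seq x n) (seq y n) (seq z n)))

⊵-trans : ∀ {x y z} → x ⊵ y → y ⊵ z → x ⊵ z
⊵-trans {x} {y} {z} (w , 1<w , y≤wx) (v , 1<v , z≤vy) = v *ℝ w , 1<* v w 1<v 1<w ,
  ≤-trans {z} {v *ℝ y} {v *ℝ w *ℝ x} z≤vy
    (≤-resp-≈ {v *ℝ y} {v *ℝ y} {v *ℝ (w *ℝ x)} {v *ℝ w *ℝ x}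
      (≈-refl {v *ℝ y}) (*-assoc-≈ v w x) (*-monoˡ-≤ v {y} {w *ℝ x} (0<1< v 1<v) y≤wx))

⊳-⊵-trans : ∀ {x y z} → x ⊳ y → y ⊵ z → x ⊳ z
⊳-⊵-trans {x} {y} {z} (w , 1<w , y<wx) (v , 1<v , z≤vy) = v *ℝ w , 1<* v w 1<v 1<w ,
  ≤-<-trans {z} {v *ℝ y} {v *ℝ w *ℝ x} z≤vy
    (<-resp-≈ {v *ℝ y} {v *ℝ y} {v *ℝ (w *ℝ x)} {v *ℝ w *ℝ x}
      (≈-refl {v *ℝ y}) (*-assoc-≈ v w x) (*-monoˡ-< v {y} {w *ℝ x} (0<1< v 1<v) y<wx))

⊳⇒⊵ : ∀ {x y} → x ⊳ y → x ⊵ y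
⊳⇒⊵ {x} {y} (w , 1<w , y<wx) = w , 1<w , <⇒≤ {y} {w *ℝ x} y<wx

⊳-trans : ∀ {x y z} → x ⊳ y → y ⊳ z → x ⊳ z
⊳-trans {x} {y} {z} x⊳y y⊳z = ⊳-⊵-trans {x} {y} {z} x⊳y (⊳⇒⊵ {y} {z} y⊳z)

⊵-respʳ : ∀ {x y z} → y ≈ℝ z → x ⊵ y → x ⊵ z
⊵-respʳ {x} {y} {z} y≈z (w , 1<w , y≤wx) = w , 1<w ,
  ≤-resp-≈ {y} {z} {w *ℝ x} {w *ℝ x} y≈z (≈-refl {w *ℝ x}) y≤wx

⊳-respʳ : ∀ {x y z} → y ≈ℝ z → x ⊳ y → x ⊳ z
⊳-respʳ {x} {y} {z} y≈z (w , 1<w , y<wx) = w , 1<w ,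
  <-resp-≈ {y} {z} {w *ℝ x} {w *ℝ x} y≈z (≈-refl {w *ℝ x}) y<wx

⊵-positive : ∀ {x y} → x ⊵ y → 0ℝ <ℝ y → 0ℝ <ℝ x
⊵-positive {x} {y} (w , 1<w , y≤wx) 0<y =
  *-cancelˡ-0< w {x} (0<1< w 1<w) (<-≤-trans {0ℝ} {y} {w *ℝ x} 0<y y≤wx)

⊳-cycle : ∀ {x} → x ⊳ x → 0ℝ <ℝ x
⊳-cycle {x} (w , 1<w , x<wx) = *-cancelˡ-0< (w -ℝ 1ℝ) {x}
  (<-shift {1ℝ} {w} {0ℝ} {w -ℝ 1ℝ}
    (λ n → solve 1 (λ w → con 0ℚ :- con 1ℚ := w :- con 1ℚ :- w) refl (seq w n)) 1<w)
  (<-shift {x} {w *ℝ x} {0ℝ} {(w -ℝ 1ℝ) *ℝ x}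
    (λ n → solve 2 (λ w x → con 0ℚ :- x := (w :- con 1ℚ) :* x :- w :* x) refl (seq w n) (seq x n))
    x<wx)

-- The value Pₙ(β) for digits prescribed in advance. These are the greedy remainders as soon as all
-- terms after the first lie in [0, 1).
orbit : ℝ → (ℕ → ℤ) → ℕ → ℝ
orbit β c zero    = 1ℝ
orbit β c (suc n) = β *ℝ orbit β c n -ℝ fromℤ (c (suc n))

-- The complements 1 − rₙ satisfy β (1 − rₙ) = (c₁ − cₙ₊₁) + r₁ − rₙ₊₁, so they dominate the next
-- complement if cₙ₊₁ < c₁, and the next but one if cₙ₊₁ = c₁ and cₙ₊₂ < c₂.

module _ (β : ℝ) (1<β : 1ℝ <ℝ β) (c : ℕ → ℤ) where
  private
    r s : ℕ → ℝ
    r = orbit β c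
    s n = 1ℝ -ℝ r n

  -- The factor is β, because β rₙ exceeds rₙ₊₁ by exactly the digit cₙ₊₁. A positive digit leaves a
  -- gap of at least 1, which makes the domination strict.
  orbit-⊵ : ∀ n → + 0 ≤ c (suc n) → r n ⊵ r (suc n)
  orbit-⊵ n 0≤c = β , 1<β , pointwise-≤ {r (suc n)} {β *ℝ r n} λ i →
    let βr = seq β i ℚ.* seq (r n) i in begin
    βr ℚ.- ι (c (suc n))    ≤⟨ ℚₚ.+-monoʳ-≤ βr (ℚₚ.neg-antimono-≤ (ι-mono-≤ 0≤c)) ⟩
    βr ℚ.+ 0ℚ               ≡⟨ ℚₚ.+-identityʳ βr ⟩
    βr                      ∎
    where open ℚₚ.≤-Reasoning

  orbit-⊳ : ∀ n → + 1 ≤ c (suc n) → r n ⊳ r (suc n)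
  orbit-⊳ n 1≤c = β , 1<β , <-by-positive 1ℝ {r (suc n)} {β *ℝ r n} 0ℝ<1ℝ λ i →
    let βr = seq β i ℚ.* seq (r n) i in begin
    βr ℚ.- ι (c (suc n)) ℚ.+ 1ℚ
      ≤⟨ ℚₚ.+-monoˡ-≤ 1ℚ (ℚₚ.+-monoʳ-≤ βr (ℚₚ.neg-antimono-≤ (ι-mono-≤ 1≤c))) ⟩
    βr ℚ.- 1ℚ ℚ.+ 1ℚ
      ≡⟨ solve 1 (λ x → x :- con 1ℚ :+ con 1ℚ := x) refl βr ⟩
    βr ∎
    where open ℚₚ.≤-Reasoning

  private
    0≤ι-gap : ∀ {x y} → x ℤ.< y → 0ℚ ℚ.≤ ι y ℚ.- ι x ℚ.- 1ℚ
    0≤ι-gap {x} {y} x<y = begin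
      0ℚ
        ≡⟨ solve 1 (λ x → con 0ℚ := con 1ℚ :+ x :- x :- con 1ℚ) refl (ι x) ⟩
      1ℚ ℚ.+ ι x ℚ.- ι x ℚ.- 1ℚ
        ≡⟨ cong (λ z → z ℚ.- ι x ℚ.- 1ℚ) (ι-+ (+ 1) x) ⟨
      ι (+ 1 + x) ℚ.- ι x ℚ.- 1ℚ
        ≤⟨ ℚₚ.+-monoˡ-≤ (ℚ.- 1ℚ) (ℚₚ.+-monoˡ-≤ (ℚ.- ι x) (ι-mono-≤ (ℤₚ.i<j⇒suc[i]≤j x<y))) ⟩
      ι y ℚ.- ι x ℚ.- 1ℚ ∎
      where open ℚₚ.≤-Reasoning

    p≤p+q : ∀ p {q} → 0ℚ ℚ.≤ q → p ℚ.≤ p ℚ.+ q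
    p≤p+q p 0≤q = subst (ℚ._≤ p ℚ.+ _) (ℚₚ.+-identityʳ p) (ℚₚ.+-monoʳ-≤ p 0≤q)

  complement-⊳₁ : 0ℝ <ℝ r 1 → ∀ n → c (suc n) ℤ.< c 1 → s n ⊳ s (suc n)
  -- Here β sₙ = sₙ₊₁ + r₁ + (c₁ - cₙ₊₁ - 1) with a nonnegative last term, so r₁ serves as the
  -- positive gap.
  complement-⊳₁ 0<r₁ n e<c₁ = β , 1<β , <-by-positive (r 1) {s (suc n)} {β *ℝ s n} 0<r₁ λ i →
    ℚₚ.≤-trans
      (p≤p+q (seq (s (suc n)) i ℚ.+ seq (r 1) i) (0≤ι-gap e<c₁))
      (ℚₚ.≤-reflexive (solve 4 (λ x ρ e k →
        con 1ℚ :- (x :* ρ :- e) :+ (x :* con 1ℚ :- k) :+ (k :- e :- con 1ℚ) := x :* (con 1ℚ :- ρ))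
        refl (seq β i) (seq (r n) i) (ι (c (suc n))) (ι (c 1))))

  complement-⊳₂ : 0ℝ <ℝ r 2 → ∀ n → c (suc n) ≡ c 1 → c (suc (suc n)) ℤ.< c 2 →
                  s n ⊳ s (suc (suc n))
  -- The equal digits cancel, which leaves β² sₙ = sₙ₊₂ + r₂ + (c₂ - cₙ₊₂ - 1); now r₂ is the gap.
  complement-⊳₂ 0<r₂ n e≡c₁ e′<c₂ = β *ℝ β , 1<* β β 1<β 1<β ,
    <-by-positive (r 2) {s (suc (suc n))} {β *ℝ β *ℝ s n} 0<r₂ λ i →
    ℚₚ.≤-trans
      (p≤p+q (seq (s (suc (suc n))) i ℚ.+ seq (r 2) i) (0≤ι-gap e′<c₂))
      (ℚₚ.≤-reflexive (identity (seq β i) (seq (r n) i) (cong ι e≡c₁)))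
    where
    identity : ∀ x ρ {e k e′ k′} → e ≡ k →
      1ℚ ℚ.- (x ℚ.* (x ℚ.* ρ ℚ.- e) ℚ.- e′) ℚ.+ (x ℚ.* (x ℚ.* 1ℚ ℚ.- k) ℚ.- k′)
        ℚ.+ (k′ ℚ.- e′ ℚ.- 1ℚ) ≡ x ℚ.* x ℚ.* (1ℚ ℚ.- ρ)
    identity x ρ {k = k} {e′} {k′} refl = solve 5 (λ x ρ k e′ k′ →
      con 1ℚ :- (x :* (x :* ρ :- k) :- e′) :+ (x :* (x :* con 1ℚ :- k) :- k′)
        :+ (k′ :- e′ :- con 1ℚ) := x :* x :* (con 1ℚ :- ρ)) refl x ρ k e′ k′

  -- One move of the lexicographic comparison: a smaller digit decides at once and passes to n + 1,
  -- an equal digit leaves the decision to the next one and passes to n + 2.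
  complement-⊳ : 0ℝ <ℝ r 1 → 0ℝ <ℝ r 2 → ∀ n {z} → c (suc n) ≤ c 1 →
                 (c (suc n) ≡ c 1 → c (suc (suc n)) ℤ.< c 2) →
                 s (suc n) ⊳ z → s (suc (suc n)) ⊳ z → s n ⊳ z
  complement-⊳ 0<r₁ 0<r₂ n {z} e≤c₁ next s₁⊳z s₂⊳z with ℤₚ.<-cmp (c (suc n)) (c 1)
  ... | tri< e<c₁ _ _ = ⊳-trans {s n} {s (suc n)} {z} (complement-⊳₁ 0<r₁ n e<c₁) s₁⊳z
  ... | tri≈ _ e≡c₁ _ =
    ⊳-trans {s n} {s (suc (suc n))} {z} (complement-⊳₂ 0<r₂ n e≡c₁ (next e≡c₁)) s₂⊳z
  ... | tri> _ _ c₁<e = ⊥-elim (ℤₚ.<-irrefl refl (ℤₚ.<-≤-trans c₁<e e≤c₁))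

-- The greedy expansion with preperiod 1 and period 7

digits : (k₁ k₂ k₃ k₄ : ℤ) → ℕ → ℤ
digits k₁ k₂ k₃ k₄ = λ
  { 0             → + 0
  ; 1             → k₁
  ; (suc (suc n)) → word n
  }
  where
  word : ℕ → ℤ
  word 0 = k₂
  word 1 = k₃
  word 2 = k₄
  word 3 = k₃
  word 4 = k₂
  word 5 = k₁ - + 1
  word 6 = k₁ - + 1
  -- Recursion by seven makes the periodicity hold by computation from the second digit on.
  word (suc (suc (suc (suc (suc (suc (suc n))))))) = word n

module DigitExpansion
  (β : ℝ) (1<β : 1ℝ <ℝ β) (k₁ k₂ k₃ k₄ : ℤ)
  (2≤k₁ : + 2 ≤ k₁) (k₂≤k₁ : k₂ ≤ k₁) (k₃<k₂ : k₃ ℤ.< k₂) (0≤k₃ : + 0 ≤ k₃)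
  (0≤k₄ : + 0 ≤ k₄) (k₄≤k₁ : k₄ ≤ k₁)
  (closed : orbit β (digits k₁ k₂ k₃ k₄) 8 ≈ℝ orbit β (digits k₁ k₂ k₃ k₄) 1)
  where

  private
    c : ℕ → ℤ
    c = digits k₁ k₂ k₃ k₄

    r s : ℕ → ℝ
    r = orbit β c
    s n = 1ℝ -ℝ r n

    1≤k₁-1 : + 1 ≤ k₁ - + 1
    1≤k₁-1 = ℤₚ.+-monoˡ-≤ (- + 1) 2≤k₁

    0≤k₁-1 : + 0 ≤ k₁ - + 1
    0≤k₁-1 = ℤₚ.≤-trans (ℤ.+≤+ ℕ.z≤n) 1≤k₁-1

    0≤k₂ : + 0 ≤ k₂
    0≤k₂ = ℤₚ.≤-trans 0≤k₃ (ℤₚ.<⇒≤ k₃<k₂)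

    k₁-1<k₁ : k₁ - + 1 ℤ.< k₁
    k₁-1<k₁ = ℤₚ.i≤pred[j]⇒i<j (ℤₚ.≤-reflexive (ℤₚ.+-comm k₁ (- + 1)))

    r₇⊵r₁ = ⊵-respʳ {r 7} {r 8} {r 1} closed (orbit-⊵ β 1<β c 7 0≤k₁-1)
    r₁⊵r₂ = orbit-⊵ β 1<β c 1 0≤k₂
    r₂⊵r₃ = orbit-⊵ β 1<β c 2 0≤k₃
    r₃⊵r₄ = orbit-⊵ β 1<β c 3 0≤k₄
    r₄⊵r₅ = orbit-⊵ β 1<β c 4 0≤k₃
    r₅⊵r₆ = orbit-⊵ β 1<β c 5 0≤k₂

    r₄⊵r₆ = ⊵-trans {r 4} {r 5} {r 6} r₄⊵r₅ r₅⊵r₆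
    r₃⊵r₆ = ⊵-trans {r 3} {r 4} {r 6} r₃⊵r₄ r₄⊵r₆
    r₂⊵r₆ = ⊵-trans {r 2} {r 3} {r 6} r₂⊵r₃ r₃⊵r₆
    r₁⊵r₆ = ⊵-trans {r 1} {r 2} {r 6} r₁⊵r₂ r₂⊵r₆
    r₇⊵r₆ = ⊵-trans {r 7} {r 1} {r 6} r₇⊵r₁ r₁⊵r₆

    0<r₆ : 0ℝ <ℝ r 6
    -- The digit c₇ = k₁ - 1 ≥ 1 supplies the strict step of the cycle 6, 7, 1, 2, ..., 6; all its
    -- other steps use only nonnegative digits.
    0<r₆ = ⊳-cycle {r 6} (⊳-⊵-trans {r 6} {r 7} {r 6} (orbit-⊳ β 1<β c 6 1≤k₁-1) r₇⊵r₆)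

    0<r₁ : 0ℝ <ℝ r 1
    0<r₁ = ⊵-positive {r 1} {r 6} r₁⊵r₆ 0<r₆

    0<r₂ : 0ℝ <ℝ r 2
    0<r₂ = ⊵-positive {r 2} {r 6} r₂⊵r₆ 0<r₆

    s₈≈s₁ : s 8 ≈ℝ s 1
    s₈≈s₁ ε 0<ε with N , h ← closed ε 0<ε = N , λ n p → subst (ℚ._≤ ε)
      (trans (∣p-q∣≡∣q-p∣ (seq (r 8) n) (seq (r 1) n))
        (cong ∣_∣ (solve 2 (λ x y → y :- x := con 1ℚ :- x :- (con 1ℚ :- y)) refl
          (seq (r 8) n) (seq (r 1) n))))
      (h n p)

    step : ∀ n {z} → c (suc n) ≤ c 1 → (c (suc n) ≡ c 1 → c (suc (suc n)) ℤ.< c 2) →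
           s (suc n) ⊳ z → s (suc (suc n)) ⊳ z → s n ⊳ z
    step = complement-⊳ β 1<β c 0<r₁ 0<r₂

    k₃<k₁ : k₃ ℤ.< k₁
    k₃<k₁ = ℤₚ.<-≤-trans k₃<k₂ k₂≤k₁

    -- Backward induction around the cycle begins here and ends with `s 1 ⊳ s 1`. A digit known to
    -- be below k₁ moves one index on; a digit that may equal k₁ needs its successor compared with
    -- k₂.
    s₇⊳s₁ : s 7 ⊳ s 1
    s₇⊳s₁ = ⊳-respʳ {s 7} {s 8} {s 1} s₈≈s₁ (complement-⊳₁ β 1<β c 0<r₁ 7 k₁-1<k₁)

    s₆⊳s₁ : s 6 ⊳ s 1
    s₆⊳s₁ = ⊳-trans {s 6} {s 7} {s 1} (complement-⊳₁ β 1<β c 0<r₁ 6 k₁-1<k₁) s₇⊳s₁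

    s₅⊳s₁ : s 5 ⊳ s 1
    -- In the case k₂ = k₁ the next digit is k₁ - 1, which lies below k₁ and hence below k₂.
    s₅⊳s₁ = step 5 {s 1} k₂≤k₁ (λ { refl → k₁-1<k₁ }) s₆⊳s₁ s₇⊳s₁

    s₄⊳s₁ : s 4 ⊳ s 1
    s₄⊳s₁ = ⊳-trans {s 4} {s 5} {s 1} (complement-⊳₁ β 1<β c 0<r₁ 4 k₃<k₁) s₅⊳s₁

    s₃⊳s₁ : s 3 ⊳ s 1
    s₃⊳s₁ = step 3 {s 1} k₄≤k₁ (λ _ → k₃<k₂) s₄⊳s₁ s₅⊳s₁

    s₂⊳s₁ : s 2 ⊳ s 1
    s₂⊳s₁ = ⊳-trans {s 2} {s 3} {s 1} (complement-⊳₁ β 1<β c 0<r₁ 2 k₃<k₁) s₃⊳s₁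

    0<s₁ : 0ℝ <ℝ s 1
    0<s₁ = ⊳-cycle {s 1} (step 1 {s 1} k₂≤k₁ (λ _ → k₃<k₂) s₂⊳s₁ s₃⊳s₁)

    r-periodic : ∀ n → r (8 ℕ.+ n) ≈ℝ r (suc n)
    r-periodic zero    = closed
    r-periodic (suc n) = -ℝ-congʳ {β *ℝ r (8 ℕ.+ n)} {β *ℝ r (suc n)} (fromℤ (c (suc (suc n))))
      (*-congˡ β {r (8 ℕ.+ n)} {r (suc n)} (r-periodic n))

    s⇒r<1 : ∀ n → 0ℝ <ℝ s n → r n <ℝ 1ℝ
    s⇒r<1 n = <-shift {0ℝ} {s n} {r n} {1ℝ} λ i →
      solve 1 (λ r → r :- con 0ℚ := con 1ℚ :- (con 1ℚ :- r)) refl (seq (r n) i)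

    via-s₁ : ∀ n → s n ⊳ s 1 → r n <ℝ 1ℝ
    via-s₁ n sₙ⊳s₁ = s⇒r<1 n (⊵-positive {s n} {s 1} (⊳⇒⊵ {s n} {s 1} sₙ⊳s₁) 0<s₁)

    via-r₆ : ∀ n → r n ⊵ r 6 → 0ℝ <ℝ r n
    via-r₆ n rₙ⊵r₆ = ⊵-positive {r n} {r 6} rₙ⊵r₆ 0<r₆

    -- The count starts at r₁ because r₀ = 1 is outside the open interval. Seven cases go once
    -- around the cycle, and the last clause descends by a period.
    in-unit-interval : ∀ n → 0ℝ <ℝ r (suc n) × r (suc n) <ℝ 1ℝ
    in-unit-interval 0 = 0<r₁ , s⇒r<1 1 0<s₁
    in-unit-interval 1 = 0<r₂ , via-s₁ 2 s₂⊳s₁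
    in-unit-interval 2 = via-r₆ 3 r₃⊵r₆ , via-s₁ 3 s₃⊳s₁
    in-unit-interval 3 = via-r₆ 4 r₄⊵r₆ , via-s₁ 4 s₄⊳s₁
    in-unit-interval 4 = via-r₆ 5 r₅⊵r₆ , via-s₁ 5 s₅⊳s₁
    in-unit-interval 5 = 0<r₆ , via-s₁ 6 s₆⊳s₁
    in-unit-interval 6 = via-r₆ 7 r₇⊵r₆ , via-s₁ 7 s₇⊳s₁
    in-unit-interval (suc (suc (suc (suc (suc (suc (suc n))))))) =
      let 0<r , r<1 = in-unit-interval n
          r≈        = ≈-sym {r (8 ℕ.+ n)} {r (suc n)} (r-periodic n)
      in <-resp-≈ {0ℝ} {0ℝ} {r (suc n)} {r (8 ℕ.+ n)} (≈-refl {0ℝ}) r≈ 0<r ,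
         <-resp-≈ {r (suc n)} {r (8 ℕ.+ n)} {1ℝ} {1ℝ} r≈ (≈-refl {1ℝ}) r<1

    -- Since β rₙ - cₙ₊₁ = rₙ₊₁ lies strictly between 0 and 1, the prescribed digit is the greedy
    -- one.
    floor : ∀ n → IsFloor (β *ℝ r n) (c (suc n))
    floor n = let 0<r , r<1 = in-unit-interval n in
      ≤-shift {0ℝ} {r (suc n)} {fromℤ (c (suc n))} {β *ℝ r n}
        (λ i → solve 2 (λ y k → k :- con 0ℚ := y :- (y :- k)) refl (seq (β *ℝ r n) i) (ι (c (suc n))))
        (<⇒≤ {0ℝ} {r (suc n)} 0<r) ,
      <-shift {r (suc n)} {1ℝ} {β *ℝ r n} {fromℤ (c (suc n) + + 1)}
        (λ i → trans
          (solve 2 (λ y k → y :- (y :- k) := k :+ con 1ℚ :- con 1ℚ) refl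
            (seq (β *ℝ r n) i) (ι (c (suc n))))
          (cong (ℚ._- 1ℚ) (sym (ι-+ (c (suc n)) (+ 1)))))
        r<1

    nonzero : ∀ n → ¬ (r n ≈ℝ 0ℝ)
    nonzero zero    = 0<⇒≉0 {r 0} 0ℝ<1ℝ
    nonzero (suc n) = 0<⇒≉0 {r (suc n)} (proj₁ (in-unit-interval n))

    -- Seven is prime, so a shorter eventual period would force c₂ ≡ c₃.

    +-swap : ∀ x y z → x ℕ.+ y ℕ.+ z ≡ x ℕ.+ z ℕ.+ y
    +-swap x y z = trans (ℕₚ.+-assoc x y z)
      (trans (cong (x ℕ.+_) (ℕₚ.+-comm y z)) (sym (ℕₚ.+-assoc x z y)))

    7-periodic : ∀ n → 2 ℕ.≤ n → c (7 ℕ.+ n) ≡ c n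
    7-periodic (suc (suc n)) (ℕ.s≤s (ℕ.s≤s ℕ.z≤n)) = refl

    7*-periodic : ∀ k n → 2 ℕ.≤ n → c (k ℕ.* 7 ℕ.+ n) ≡ c n
    7*-periodic zero    n 2≤n = refl
    7*-periodic (suc k) n 2≤n =
      trans (7-periodic (k ℕ.* 7 ℕ.+ n) (ℕₚ.≤-trans 2≤n (ℕₚ.m≤n+m n (k ℕ.* 7))))
        (7*-periodic k n 2≤n)

    *-periodic : ∀ {m p} → PeriodicFrom c m p → ∀ k n → 1 ℕ.≤ n →
                 c (n ℕ.+ m) ≡ c (n ℕ.+ m ℕ.+ k ℕ.* p)
    *-periodic {m} {p} per zero    n 1≤n = cong c (sym (ℕₚ.+-identityʳ (n ℕ.+ m)))
    *-periodic {m} {p} per (suc k) n 1≤n = trans (per n 1≤n) (trans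
      (cong c (+-swap n m p))
      (trans (*-periodic per k (n ℕ.+ p) (ℕₚ.≤-trans 1≤n (ℕₚ.m≤m+n n p)))
        (cong c (trans (cong (ℕ._+ k ℕ.* p) (+-swap n p m)) (ℕₚ.+-assoc (n ℕ.+ m) p (k ℕ.* p))))))

    2≤suc-suc : ∀ {n} → 2 ℕ.≤ suc (suc n)
    2≤suc-suc = ℕ.s≤s (ℕ.s≤s ℕ.z≤n)

    -- A period p from the very start would give c₁ = c at index 1 + 7p, which the 7-periodicity
    -- reduces to c₈ = k₁ - 1.
    preperiod-minimal : ∀ m p → 1 ℕ.≤ p → PeriodicFrom c m p → 1 ℕ.≤ m
    preperiod-minimal (suc m) p       1≤p per = ℕ.s≤s ℕ.z≤n
    preperiod-minimal zero    (suc p) 1≤p per = ⊥-elim (ℤₚ.<-irrefl k₁-1≡k₁ k₁-1<k₁)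
      where
      k₁-1≡k₁ : k₁ - + 1 ≡ k₁
      k₁-1≡k₁ = sym (trans (*-periodic per 7 1 (ℕ.s≤s ℕ.z≤n))
        (trans (cong (λ n → c (suc n)) (trans (ℕₚ.*-comm 7 (suc p)) (ℕₚ.+-comm 7 (p ℕ.* 7))))
          (trans (cong c (sym (ℕₚ.+-suc (p ℕ.* 7) 7))) (7*-periodic p 8 2≤suc-suc))))

    ≡1[mod7]-impossible : ∀ {m p} → PeriodicFrom c m p → ∀ k j → ¬ (k ℕ.* p ≡ suc (j ℕ.* 7))
    ≡1[mod7]-impossible {m} {p} per k j kp≡ = ℤₚ.<-irrefl (sym k₂≡k₃) k₃<k₂
      where
      n : ℕ
      -- This choice makes n + m = 7m + 2, an index past the preperiod and congruent to 2 modulo 7.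
      -- Its digit is k₂, and a shift by 1 modulo 7 leads to k₃.
      n = 2 ℕ.+ m ℕ.* 6

      n+m≡ : n ℕ.+ m ≡ m ℕ.* 7 ℕ.+ 2
      n+m≡ = trans (cong (2 ℕ.+_) (trans (ℕₚ.+-comm (m ℕ.* 6) m) (sym (ℕₚ.*-suc m 6))))
        (ℕₚ.+-comm 2 (m ℕ.* 7))

      k₂≡k₃ : k₂ ≡ k₃
      k₂≡k₃ = trans (sym (7*-periodic m 2 2≤suc-suc))
        (trans (cong c (sym n+m≡))
        (trans (*-periodic per k n (ℕ.s≤s ℕ.z≤n))
        (trans (cong c (trans (cong₂ ℕ._+_ n+m≡ kp≡) (ℕₚ.+-assoc (m ℕ.* 7) 2 (suc (j ℕ.* 7)))))
        (trans (7*-periodic m (3 ℕ.+ j ℕ.* 7) 2≤suc-suc)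
        (trans (cong c (ℕₚ.+-comm 3 (j ℕ.* 7)))
          (7*-periodic j 3 2≤suc-suc))))))

    period-minimal : ∀ m p → 1 ℕ.≤ p → PeriodicFrom c m p → 7 ℕ.≤ p
    -- The first number is an inverse k of p modulo 7, the second is j with k p = 7 j + 1.
    period-minimal m 1 _ per = ⊥-elim (≡1[mod7]-impossible per 1 0 refl)
    period-minimal m 2 _ per = ⊥-elim (≡1[mod7]-impossible per 4 1 refl)
    period-minimal m 3 _ per = ⊥-elim (≡1[mod7]-impossible per 5 2 refl)
    period-minimal m 4 _ per = ⊥-elim (≡1[mod7]-impossible per 2 1 refl)
    period-minimal m 5 _ per = ⊥-elim (≡1[mod7]-impossible per 3 2 refl)
    period-minimal m 6 _ per = ⊥-elim (≡1[mod7]-impossible per 6 5 refl)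
    period-minimal m (suc (suc (suc (suc (suc (suc (suc p))))))) _ _ = ℕₚ.m≤m+n 7 p

  hasPreperiodPeriod : HasPreperiodPeriod β 1 7 c
  hasPreperiodPeriod = record
    { remainders = r
    ; expansion  = record
      { r₀        = ≈-refl {1ℝ}
      ; digit     = floor
      ; remainder = λ n → ≈-refl {r (suc n)}
      }
    ; nonzero    = nonzero
    ; 1≤p        = ℕ.s≤s ℕ.z≤n
    ; periodic   = λ n 1≤n → sym (trans (cong c (ℕₚ.+-comm (n ℕ.+ 1) 7))
        (7-periodic (n ℕ.+ 1) (ℕₚ.+-monoˡ-≤ 1 1≤n)))
    ; minimal    = λ m p 1≤p per → preperiod-minimal m p 1≤p per , period-minimal m p 1≤p per
    }

-- Uniqueness and digit bounds of beta expansions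

<⇒≤-suc : ∀ {i j} → i ℤ.< j + + 1 → i ≤ j
<⇒≤-suc {i} {j} i<j+1 = subst (i ≤_) (ℤₚ.pred-suc j)
  (ℤₚ.i<j⇒i≤pred[j] (subst (i ℤ.<_) (ℤₚ.+-comm j (+ 1)) i<j+1))

floor-≤ : ∀ {x y k l} → x ≤ℝ y → fromℤ k ≤ℝ x → y <ℝ fromℤ (l + + 1) → k ≤ l
floor-≤ {x} {y} {k} {l} x≤y k≤x y<l+1 = <⇒≤-suc (ι-cancel-< (fromℚ-cancel-<
  (≤-<-trans {fromℤ k} {x} {fromℤ (l + + 1)} k≤x (≤-<-trans {x} {y} {fromℤ (l + + 1)} x≤y y<l+1))))

floor-unique : ∀ {x y k l} → x ≈ℝ y → IsFloor x k → IsFloor y l → k ≡ l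
floor-unique {x} {y} x≈y (k≤x , x<k+1) (l≤y , y<l+1) = ℤₚ.≤-antisym
  (floor-≤ {x} {y} (≈⇒≤ {x} {y} x≈y) k≤x y<l+1)
  (floor-≤ {y} {x} (≈⇒≤ {y} {x} (≈-sym {x} {y} x≈y)) l≤y x<k+1)

module _ {β : ℝ} {c c′ : ℕ → ℤ} {r r′ : ℕ → ℝ}
         (E : IsBetaExpansion β c r) (E′ : IsBetaExpansion β c′ r′) where
  private
    module E  = IsBetaExpansion E
    module E′ = IsBetaExpansion E′

  mutual
    -- Simultaneous induction: equal remainders give equal floors after multiplication by β, and
    -- equal digits then give equal next remainders.
    remainders-unique : ∀ n → r n ≈ℝ r′ n
    remainders-unique zero =
      ≈-trans {r 0} {1ℝ} {r′ 0} E.r₀ (≈-sym {r′ 0} {1ℝ} E′.r₀)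
    remainders-unique (suc n) =
      ≈-trans {r (suc n)} {β *ℝ r n -ℝ fromℤ (c (suc n))} {r′ (suc n)} (E.remainder n)
        (≈-trans {β *ℝ r n -ℝ fromℤ (c (suc n))} {β *ℝ r′ n -ℝ fromℤ (c (suc n))} {r′ (suc n)}
          (-ℝ-congʳ {β *ℝ r n} {β *ℝ r′ n} (fromℤ (c (suc n)))
            (*-congˡ β {r n} {r′ n} (remainders-unique n)))
          (subst (λ d → β *ℝ r′ n -ℝ fromℤ d ≈ℝ r′ (suc n)) (sym (digits-unique n))
            (≈-sym {r′ (suc n)} {β *ℝ r′ n -ℝ fromℤ (c′ (suc n))} (E′.remainder n))))

    digits-unique : ∀ n → c (suc n) ≡ c′ (suc n)
    digits-unique n = floor-unique {β *ℝ r n} {β *ℝ r′ n}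
      (*-congˡ β {r n} {r′ n} (remainders-unique n)) (E.digit n) (E′.digit n)

-- The co-factor relation quantifies over its own lengths and digits, which have to be matched with
-- 1 and 7. As the digits of both expansions agree, the minimality in each bounds its lengths by
-- those of the other.
preperiod-period-unique : ∀ {β m p m′ p′ c c′} →
  HasPreperiodPeriod β m p c → HasPreperiodPeriod β m′ p′ c′ → m ≡ m′ × p ≡ p′
preperiod-period-unique H H′ =
  let m≤m′ , p≤p′ = bound H H′
      m′≤m , p′≤p = bound H′ H
  in ℕₚ.≤-antisym m≤m′ m′≤m , ℕₚ.≤-antisym p≤p′ p′≤p
  where
  open HasPreperiodPeriod

  bound : ∀ {β m p m′ p′ c c′} → HasPreperiodPeriod β m p c → HasPreperiodPeriod β m′ p′ c′ →
          m ℕ.≤ m′ × p ℕ.≤ p′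
  bound {m′ = m′} {p′} H H′ = minimal H m′ p′ (1≤p H′) λ where
    (suc n) 1≤n → let c≡c′ = digits-unique (expansion H) (expansion H′) in
      trans (c≡c′ (n ℕ.+ m′)) (trans (periodic H′ (suc n) 1≤n) (sym (c≡c′ (n ℕ.+ m′ ℕ.+ p′))))

module DigitBounds {β : ℝ} {c : ℕ → ℤ} {r : ℕ → ℝ}
                   (1<β : 1ℝ <ℝ β) (E : IsBetaExpansion β c r) where
  open IsBetaExpansion E
  private
    0<β : 0ℝ <ℝ β
    0<β = 0<1< β 1<β

  0≤remainder : ∀ n → 0ℝ ≤ℝ r n
  0≤remainder zero    = ≤-resp-≈ {0ℝ} {0ℝ} {1ℝ} {r 0}
    (≈-refl {0ℝ}) (≈-sym {r 0} {1ℝ} r₀) (<⇒≤ {0ℝ} {1ℝ} 0ℝ<1ℝ)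
  0≤remainder (suc n) = ≤-resp-≈ {0ℝ} {0ℝ} {β *ℝ r n -ℝ fromℤ (c (suc n))} {r (suc n)}
    (≈-refl {0ℝ}) (≈-sym {r (suc n)} {β *ℝ r n -ℝ fromℤ (c (suc n))} (remainder n))
    (≤-shift {fromℤ (c (suc n))} {β *ℝ r n} {0ℝ} {β *ℝ r n -ℝ fromℤ (c (suc n))}
      (λ i → solve 2 (λ y k → con 0ℚ :- k := y :- k :- y) refl (seq (β *ℝ r n) i) (ι (c (suc n))))
      (proj₁ (digit n)))

  remainder≤1 : ∀ n → r (suc n) ≤ℝ 1ℝ
  remainder≤1 n = ≤-resp-≈ {β *ℝ r n -ℝ fromℤ (c (suc n))} {r (suc n)} {1ℝ} {1ℝ}
    (≈-sym {r (suc n)} {β *ℝ r n -ℝ fromℤ (c (suc n))} (remainder n)) (≈-refl {1ℝ})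
    (<⇒≤ {β *ℝ r n -ℝ fromℤ (c (suc n))} {1ℝ}
      (<-shift {β *ℝ r n} {fromℤ (c (suc n) + + 1)} {β *ℝ r n -ℝ fromℤ (c (suc n))} {1ℝ}
        (λ i → trans
          (solve 2 (λ y k → y :- k :- y := con 1ℚ :- (k :+ con 1ℚ)) refl
            (seq (β *ℝ r n) i) (ι (c (suc n))))
          (cong (λ z → 1ℚ ℚ.- z) (sym (ι-+ (c (suc n)) (+ 1)))))
        (proj₂ (digit n))))

  0≤digit : ∀ n → + 0 ≤ c (suc n)
  0≤digit n = floor-≤ {β *ℝ r n} {β *ℝ r n} (≈⇒≤ {β *ℝ r n} {β *ℝ r n} (≈-refl {β *ℝ r n}))
    (≤-resp-≈ {β *ℝ 0ℝ} {0ℝ} {β *ℝ r n} {β *ℝ r n}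
      (≡⇒≈ {β *ℝ 0ℝ} {0ℝ} (λ i → ℚₚ.*-zeroʳ (seq β i))) (≈-refl {β *ℝ r n})
      (*-monoˡ-≤ β {0ℝ} {r n} 0<β (0≤remainder n)))
    (proj₂ (digit n))

  -- Later remainders are at most 1 = r₀, so β rₙ₊₁ ≤ β r₀, and the floor is monotone.
  digit≤first : ∀ n → c (suc (suc n)) ≤ c 1
  digit≤first n = floor-≤ {β *ℝ r (suc n)} {β *ℝ r 0}
    (≤-resp-≈ {β *ℝ r (suc n)} {β *ℝ r (suc n)} {β *ℝ 1ℝ} {β *ℝ r 0}
      (≈-refl {β *ℝ r (suc n)}) (*-congˡ β {1ℝ} {r 0} (≈-sym {r 0} {1ℝ} r₀))
      (*-monoˡ-≤ β {r (suc n)} {1ℝ} 0<β (remainder≤1 n)))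
    (proj₁ (digit (suc n))) (proj₂ (digit 0))

-- Polynomials

-- A raw ring carries no laws, so the two laws that handle lists of unequal length are parameters; ℚ
-- and ℤ are then served by one proof.
module CoefficientAddition (K : RawRing 0ℓ 0ℓ)
  (+-identityˡ : ∀ x → RawRing._+_ K (RawRing.0# K) x ≡ x)
  (+-identityʳ : ∀ x → RawRing._+_ K x (RawRing.0# K) ≡ x) where
  private
    _⊕_ = RawRing._+_ K
  open Polynomial K

  coeff-+ₚ : ∀ p q n → coeff (p +ₚ q) n ≡ coeff p n ⊕ coeff q n
  coeff-+ₚ []      q       n       = sym (+-identityˡ (coeff q n))
  coeff-+ₚ (a ∷ p) []      n       = sym (+-identityʳ (coeff (a ∷ p) n))
  coeff-+ₚ (a ∷ p) (b ∷ q) zero    = refl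
  coeff-+ₚ (a ∷ p) (b ∷ q) (suc n) = coeff-+ₚ p q n

module ℚ+ = CoefficientAddition ℚ.+-*-rawRing ℚₚ.+-identityˡ ℚₚ.+-identityʳ
module ℤ+ = CoefficientAddition ℤ.+-*-rawRing ℤₚ.+-identityˡ ℤₚ.+-identityʳ

coeff-neg : ∀ (p : ℚ[x].Poly) n → ℚ[x].coeff (map ℚ.-_ p) n ≡ ℚ.- ℚ[x].coeff p n
coeff-neg []      n       = refl
coeff-neg (a ∷ p) zero    = refl
coeff-neg (a ∷ p) (suc n) = coeff-neg p n

coeff--ₚ : ∀ p q n → ℚ[x].coeff (p ℚ[x].-ₚ q) n ≡ ℚ[x].coeff p n ℚ.- ℚ[x].coeff q n
coeff--ₚ p q n = trans (ℚ+.coeff-+ₚ p (map ℚ.-_ q) n) (cong (ℚ[x].coeff p n ℚ.+_) (coeff-neg q n))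

coeff-ι : ∀ p n → ℚ[x].coeff (ℤ→ℚ[x] p) n ≡ ι (ℤ[x].coeff p n)
coeff-ι []      n       = refl
coeff-ι (a ∷ p) zero    = refl
coeff-ι (a ∷ p) (suc n) = coeff-ι p n

evalℝ-neg : ∀ p x n → seq (evalℝ (map ℚ.-_ p) x) n ≡ ℚ.- seq (evalℝ p x) n
evalℝ-neg []      x n = refl
evalℝ-neg (a ∷ p) x n = trans
  (cong (λ v → ℚ.- a ℚ.+ seq x n ℚ.* v) (evalℝ-neg p x n))
  (solve 3 (λ a x v → :- a :+ x :* (:- v) := :- (a :+ x :* v)) refl
    a (seq x n) (seq (evalℝ p x) n))

evalℝ-+ₚ : ∀ p q x n → seq (evalℝ (p ℚ[x].+ₚ q) x) n ≡ seq (evalℝ p x) n ℚ.+ seq (evalℝ q x) n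
evalℝ-+ₚ []      q       x n = sym (ℚₚ.+-identityˡ (seq (evalℝ q x) n))
evalℝ-+ₚ (a ∷ p) []      x n = sym (ℚₚ.+-identityʳ (seq (evalℝ (a ∷ p) x) n))
evalℝ-+ₚ (a ∷ p) (b ∷ q) x n = trans
  (cong (λ v → a ℚ.+ b ℚ.+ seq x n ℚ.* v) (evalℝ-+ₚ p q x n))
  (solve 5 (λ a b x u v → a :+ b :+ x :* (u :+ v) := a :+ x :* u :+ (b :+ x :* v)) refl
    a b (seq x n) (seq (evalℝ p x) n) (seq (evalℝ q x) n))

evalℝ--ₚ-root : ∀ p q x → evalℝ p x ≈ℝ 0ℝ → evalℝ q x ≈ℝ 0ℝ → evalℝ (p ℚ[x].-ₚ q) x ≈ℝ 0ℝ
evalℝ--ₚ-root p q x p≈0 q≈0 =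
  ≈-trans {evalℝ (p ℚ[x].-ₚ q) x} {evalℝ p x -ℝ evalℝ q x} {0ℝ}
    (≡⇒≈ {evalℝ (p ℚ[x].-ₚ q) x} {evalℝ p x -ℝ evalℝ q x} λ n →
      trans (evalℝ-+ₚ p (map ℚ.-_ q) x n) (cong (seq (evalℝ p x) n ℚ.+_) (evalℝ-neg q x n)))
    (≈-trans {evalℝ p x -ℝ evalℝ q x} {0ℝ -ℝ evalℝ q x} {0ℝ}
      (-ℝ-congʳ {evalℝ p x} {0ℝ} (evalℝ q x) p≈0) 0-q≈0)
  where
  0-q≈0 : 0ℝ -ℝ evalℝ q x ≈ℝ 0ℝ
  0-q≈0 ε 0<ε with N , h ← q≈0 ε 0<ε = N , λ n N≤n → subst (ℚ._≤ ε)
    (trans (sym (ℚₚ.∣-p∣≡∣p∣ (seq (evalℝ q x) n ℚ.- 0ℚ)))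
      (cong ∣_∣ (solve 1 (λ v → :- (v :- con 0ℚ) := con 0ℚ :- v :- con 0ℚ) refl
        (seq (evalℝ q x) n))))
    (h n N≤n)

-- Descent on the degree bound, deciding at each stage whether the highest remaining coefficient
-- vanishes; equality of rationals is decidable.
zero-or-degree : ∀ p d → (∀ n → d ℕ.≤ n → ℚ[x].coeff p n ≡ 0ℚ) →
                 (∀ n → ℚ[x].coeff p n ≡ 0ℚ) ⊎ (∃[ e ] e ℕ.< d × ℚ[x].HasDegree p e)
zero-or-degree p zero    h = inj₁ λ n → h n ℕ.z≤n
zero-or-degree p (suc d) h with ℚ[x].coeff p d ℚₚ.≟ 0ℚ
... | no ≢0  = inj₂ (d , ℕₚ.≤-refl , ≢0 , h)
... | yes ≡0 with zero-or-degree p d (λ n d≤n → case-≤ n (ℕₚ.m≤n⇒m<n∨m≡n d≤n))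
  where
  case-≤ : ∀ n → d ℕ.< n ⊎ d ≡ n → ℚ[x].coeff p n ≡ 0ℚ
  case-≤ n (inj₁ d<n)  = h n d<n
  case-≤ n (inj₂ refl) = ≡0
...   | inj₁ all-zero        = inj₁ all-zero
...   | inj₂ (e , e<d , deg) = inj₂ (e , ℕₚ.m<n⇒m<1+n e<d , deg)

-- Both polynomials are monic of the same least degree, so their difference has β as a root and a
-- smaller degree. Minimality forces it to be zero.
minimalPolynomial-unique : ∀ {β p q} → IsMinimalPolynomial β p → IsMinimalPolynomial β q →
                           p ℚ[x].≈ₚ q
minimalPolynomial-unique {β} {p} {q} (d , (p-lead , p-high) , p-root , p-min)
                                     (e , (q-lead , q-high) , q-root , q-min) =
  difference-zero (ℕₚ.≤-antisym (p-min q e (1≢0 q-lead , q-high) q-root)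
                                (q-min p d (1≢0 p-lead , p-high) p-root))
  where
  1≢0 : ∀ {x} → x ≡ 1ℚ → ¬ (x ≡ 0ℚ)
  1≢0 refl ()

  -≡0 : ∀ {x y} → x ≡ y → x ℚ.- y ≡ 0ℚ
  -≡0 {x} refl = ℚₚ.+-inverseʳ x

  difference-zero : d ≡ e → p ℚ[x].≈ₚ q
  difference-zero refl with zero-or-degree (p ℚ[x].-ₚ q) d high
    where
    agree : ∀ n → d ℕ.< n ⊎ d ≡ n → ℚ[x].coeff p n ≡ ℚ[x].coeff q n
    agree n (inj₁ d<n)  = trans (p-high n d<n) (sym (q-high n d<n))
    agree n (inj₂ refl) = trans p-lead (sym q-lead)

    high : ∀ n → d ℕ.≤ n → ℚ[x].coeff (p ℚ[x].-ₚ q) n ≡ 0ℚ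
    high n d≤n = trans (coeff--ₚ p q n) (-≡0 (agree n (ℕₚ.m≤n⇒m<n∨m≡n d≤n)))
  ... | inj₁ all-zero = λ n → trans
    (solve 2 (λ x y → x := x :- y :+ y) refl (ℚ[x].coeff p n) (ℚ[x].coeff q n))
    (trans (cong (ℚ._+ ℚ[x].coeff q n) (trans (sym (coeff--ₚ p q n)) (all-zero n)))
      (ℚₚ.+-identityˡ (ℚ[x].coeff q n)))
  ... | inj₂ (k , k<d , deg) = ⊥-elim (ℕₚ.<⇒≱ k<d
    (p-min (p ℚ[x].-ₚ q) k deg (evalℝ--ₚ-root p q β p-root q-root)))

-- Multiplication by (x + 1)² and comparison of coefficients

Q : ℤ[x].Poly
Q = + 1 ∷ + 2 ∷ + 1 ∷ []

coeff-*Q₀ : ∀ p → ℤ[x].coeff (p ℤ[x].*ₚ Q) 0 ≡ ℤ[x].coeff p 0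
coeff-*Q₀ []      = refl
coeff-*Q₀ (a ∷ p) = trans (ℤₚ.+-identityʳ (a * + 1)) (ℤₚ.*-identityʳ a)

coeff-*Q₁ : ∀ p → ℤ[x].coeff (p ℤ[x].*ₚ Q) 1 ≡ ℤ[x].coeff p 1 + + 2 * ℤ[x].coeff p 0
coeff-*Q₁ []      = refl
coeff-*Q₁ (a ∷ p) = trans (ℤ+.coeff-+ₚ (map (a *_) Q) (+ 0 ∷ p ℤ[x].*ₚ Q) 1)
  (trans (cong (λ z → a * + 2 + z) (coeff-*Q₀ p)) (rearrange a (ℤ[x].coeff p 0)))
  where
  rearrange : ∀ a x → a * + 2 + x ≡ x + + 2 * a
  rearrange = solve-∀

coeff-*Q₂ : ∀ p n → ℤ[x].coeff (p ℤ[x].*ₚ Q) (suc (suc n)) ≡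
  ℤ[x].coeff p (suc (suc n)) + + 2 * ℤ[x].coeff p (suc n) + ℤ[x].coeff p n
coeff-*Q₂ []      n       = refl
coeff-*Q₂ (a ∷ p) zero    = trans (ℤ+.coeff-+ₚ (map (a *_) Q) (+ 0 ∷ p ℤ[x].*ₚ Q) 2)
  (trans (cong (λ z → a * + 1 + z) (coeff-*Q₁ p))
    (rearrange a (ℤ[x].coeff p 1) (ℤ[x].coeff p 0)))
  where
  rearrange : ∀ a x y → a * + 1 + (x + + 2 * y) ≡ x + + 2 * y + a
  rearrange = solve-∀
coeff-*Q₂ (a ∷ p) (suc n) = trans
  (ℤ+.coeff-+ₚ (map (a *_) Q) (+ 0 ∷ p ℤ[x].*ₚ Q) (suc (suc (suc n))))
  (trans (ℤₚ.+-identityˡ (ℤ[x].coeff (p ℤ[x].*ₚ Q) (suc (suc n)))) (coeff-*Q₂ p n))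

sextic : (a b c : ℤ) → ℤ[x].Poly
sextic a b c = + 1 ∷ a ∷ b ∷ c ∷ b ∷ a ∷ + 1 ∷ []

-- The negated coefficients of x⁷, x⁶, x⁵ and x⁴ in P (x + 1)². The last three share the shape -(x +
-- (y + y) + z), coming from the weights 1, 2, 1, so that additivity carries them through `ι`.
record Digits (a b c k₁ k₂ k₃ k₄ : ℤ) : Set where
  constructor mkDigits
  field
    k₁≡ : k₁ ≡ - (a + + 2)
    k₂≡ : k₂ ≡ - (b + (a + a) + + 1)
    k₃≡ : k₃ ≡ - (a + (b + b) + c)
    k₄≡ : k₄ ≡ - (b + (c + c) + b)

companion⇒digits : ∀ a b c d μ → companion d 1 7 ℤ[x].≈ₚ μ ℤ[x].*ₚ Q → μ ℤ[x].≈ₚ sextic a b c →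
                   Digits a b c (d 1) (d 2) (d 3) (d 4)
companion⇒digits a b c d μ companion≈ μ≈ = mkDigits
  -- For 1 ≤ i ≤ 6 the coefficient of x to the power 8 - i in P₈ - P₁ is -dᵢ, since P₁ contributes
  -- only to the two lowest coefficients.
  (trans (digit (d 1) 5 (companion≈ 7)) (expand₁ a))
  (trans (digit (d 2) 4 (companion≈ 6)) (expand₂ a b))
  (trans (digit (d 3) 3 (companion≈ 5)) (expand₃ a b c))
  (trans (digit (d 4) 2 (companion≈ 4)) (expand₄ b c))
  where
  P = sextic a b c

  digit : ∀ k n → - k ≡ ℤ[x].coeff (μ ℤ[x].*ₚ Q) (suc (suc n)) →
          k ≡ - (ℤ[x].coeff P (suc (suc n)) + + 2 * ℤ[x].coeff P (suc n) + ℤ[x].coeff P n)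
  digit k n eq = trans (sym (ℤₚ.neg-involutive k)) (cong -_ (trans eq (trans (coeff-*Q₂ μ n)
    (cong₂ _+_ (cong₂ (λ x y → x + + 2 * y) (μ≈ (suc (suc n))) (μ≈ (suc n))) (μ≈ n)))))

  expand₁ : ∀ a → - (+ 0 + + 2 * + 1 + a) ≡ - (a + + 2)
  expand₁ = solve-∀
  expand₂ : ∀ a b → - (+ 1 + + 2 * a + b) ≡ - (b + (a + a) + + 1)
  expand₂ = solve-∀
  expand₃ : ∀ a b c → - (a + + 2 * b + c) ≡ - (a + (b + b) + c)
  expand₃ = solve-∀
  expand₄ : ∀ b c → - (b + + 2 * c + b) ≡ - (b + (c + c) + b)
  expand₄ = solve-∀

digits⇒companion : ∀ {a b c k₁ k₂ k₃ k₄} → Digits a b c k₁ k₂ k₃ k₄ →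
                   companion (digits k₁ k₂ k₃ k₄) 1 7 ℤ[x].≈ₚ sextic a b c ℤ[x].*ₚ Q
digits⇒companion {a} {b} {c} {k₁} {k₂} {k₃} {k₄} (mkDigits refl refl refl refl) = coefficients
  where
  -- The choice c₇ = c₈ = k₁ - 1 fits the two lowest coefficients: -c₈ + c₁ = 1 and -c₇ - 1 = a + 2.
  -- The primed identities are the mirror images under the symmetry of P.
  low : ∀ a → - (- (a + + 2) - + 1) + - (- (- (a + + 2))) ≡ + 1
  low = solve-∀
  linear : ∀ a → - (- (a + + 2) - + 1) + - (+ 1) ≡ a + + 2 * + 1
  linear = solve-∀
  expand₁ : ∀ a → - (- (a + + 2)) ≡ + 0 + + 2 * + 1 + a
  expand₁ = solve-∀
  expand₂ : ∀ a b → - (- (b + (a + a) + + 1)) ≡ + 1 + + 2 * a + b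
  expand₂ = solve-∀
  expand₂′ : ∀ a b → - (- (b + (a + a) + + 1)) ≡ b + + 2 * a + + 1
  expand₂′ = solve-∀
  expand₃ : ∀ a b c → - (- (a + (b + b) + c)) ≡ a + + 2 * b + c
  expand₃ = solve-∀
  expand₃′ : ∀ a b c → - (- (a + (b + b) + c)) ≡ c + + 2 * b + a
  expand₃′ = solve-∀
  expand₄ : ∀ b c → - (- (b + (c + c) + b)) ≡ b + + 2 * c + b
  expand₄ = solve-∀

  P = sextic a b c

  via : ∀ {k} n → k ≡ ℤ[x].coeff P (suc (suc n)) + + 2 * ℤ[x].coeff P (suc n) + ℤ[x].coeff P n →
        k ≡ ℤ[x].coeff (P ℤ[x].*ₚ Q) (suc (suc n))
  via n eq = trans eq (sym (coeff-*Q₂ P n))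

  coefficients : companion (digits k₁ k₂ k₃ k₄) 1 7 ℤ[x].≈ₚ P ℤ[x].*ₚ Q
  coefficients 0 = trans (low a) (sym (coeff-*Q₀ P))
  coefficients 1 = trans (linear a) (sym (coeff-*Q₁ P))
  coefficients 2 = via 0 (expand₂′ a b)
  coefficients 3 = via 1 (expand₃′ a b c)
  coefficients 4 = via 2 (expand₄ b c)
  coefficients 5 = via 3 (expand₃ a b c)
  coefficients 6 = via 4 (expand₂ a b)
  coefficients 7 = via 5 (expand₁ a)
  coefficients 8 = via 6 refl
  coefficients (suc (suc (suc (suc (suc (suc (suc (suc (suc n))))))))) = via (7 ℕ.+ n) refl

-- Over ℤ, the conditions of the theorem are k₂ ≤ k₁, k₃ ≥ 0 and k₄ ≤ k₁: each of their
-- five differences is a nonnegative combination of k₁ − k₂, k₃ and k₁ − k₄.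

Conditions : (a b c : ℤ) → Set
Conditions a b c =
  a ≤ - (+ 4)
  × (+ 2 - + 2 * a ≤ + 2 * b × + 2 * b ≤ - (+ 3) * a - + 2)
  × (a - + 2 * b + + 2 ≤ + 2 * c × + 2 * c ≤ - (+ 2) * a - + 4 * b)

0≤+ : ∀ {i j} → + 0 ≤ i → + 0 ≤ j → + 0 ≤ i + j
0≤+ = ℤₚ.+-mono-≤

0≤-half : ∀ i → + 0 ≤ i + i → + 0 ≤ i
0≤-half (+ n) _ = ℤ.+≤+ ℕ.z≤n

≤-from : ∀ {i j d} → j - i ≡ d → + 0 ≤ d → i ≤ j
≤-from eq 0≤d = ℤₚ.0≤i-j⇒j≤i (subst (+ 0 ≤_) (sym eq) 0≤d)

digits⇒conditions : ∀ {a b c k₁ k₂ k₃ k₄} → Digits a b c k₁ k₂ k₃ k₄ →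
                    k₂ ≤ k₁ → + 0 ≤ k₃ → k₄ ≤ k₁ → Conditions a b c
digits⇒conditions {a} {b} {c} {k₁} {k₂} {k₃} {k₄} (mkDigits refl refl refl refl) k₂≤k₁ 0≤k₃ k₄≤k₁ =
  ≤-from (eq₁ a b c) (0≤+ D₁₄ (0≤+ (0≤+ D₁₂ D₁₂) (0≤+ 0≤k₃ 0≤k₃))) ,
  (≤-from (eq₂ a b) (0≤+ D₁₂ D₁₂) , ≤-from (eq₃ a b c) (0≤+ D₁₄ (0≤+ 0≤k₃ 0≤k₃))) ,
  (≤-from (eq₄ a b c) D₁₄ , ≤-from (eq₅ a b c) (0≤+ 0≤k₃ 0≤k₃))
  where
  D₁₂ = ℤₚ.i≤j⇒0≤j-i k₂≤k₁
  D₁₄ = ℤₚ.i≤j⇒0≤j-i k₄≤k₁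

  eq₁ : ∀ a b c → - (+ 4) - a ≡
    (- (a + + 2) - - (b + (c + c) + b))
      + (((- (a + + 2) - - (b + (a + a) + + 1)) + (- (a + + 2) - - (b + (a + a) + + 1)))
        + (- (a + (b + b) + c) + - (a + (b + b) + c)))
  eq₁ = solve-∀
  eq₂ : ∀ a b → + 2 * b - (+ 2 - + 2 * a) ≡
    (- (a + + 2) - - (b + (a + a) + + 1)) + (- (a + + 2) - - (b + (a + a) + + 1))
  eq₂ = solve-∀
  eq₃ : ∀ a b c → - (+ 3) * a - + 2 - + 2 * b ≡
    (- (a + + 2) - - (b + (c + c) + b)) + (- (a + (b + b) + c) + - (a + (b + b) + c))
  eq₃ = solve-∀
  eq₄ : ∀ a b c → + 2 * c - (a - + 2 * b + + 2) ≡ - (a + + 2) - - (b + (c + c) + b)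
  eq₄ = solve-∀
  eq₅ : ∀ a b c → - (+ 2) * a - + 4 * b - + 2 * c ≡ - (a + (b + b) + c) + - (a + (b + b) + c)
  eq₅ = solve-∀

record Admissible (k₁ k₂ k₃ k₄ : ℤ) : Set where
  field
    2≤k₁  : + 2 ≤ k₁
    k₂≤k₁ : k₂ ≤ k₁
    k₃<k₂ : k₃ ℤ.< k₂
    0≤k₃  : + 0 ≤ k₃
    0≤k₄  : + 0 ≤ k₄
    k₄≤k₁ : k₄ ≤ k₁

-- The bounds beyond the three basic ones come from k₁ - 2 = -4 - a, 2 (k₂ - k₃ - 1) = (k₁ - k₄) +
-- (-4 - a) + 2 and k₄ = 2 + 2 (k₁ - k₂) + 2 k₃.
conditions⇒admissible : ∀ {a b c k₁ k₂ k₃ k₄} → Digits a b c k₁ k₂ k₃ k₄ →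
                        Conditions a b c → Admissible k₁ k₂ k₃ k₄
conditions⇒admissible {a} {b} {c} {k₁} {k₂} {k₃} {k₄} (mkDigits refl refl refl refl)
  (a≤-4 , (2-2a≤2b , _) , (low≤2c , 2c≤high)) = record
  { 2≤k₁  = ≤-from (eq₁ a) 0≤-4-a
  ; k₂≤k₁ = ≤-from refl 0≤k₁-k₂
  ; k₃<k₂ = ℤₚ.suc[i]≤j⇒i<j (≤-from refl (0≤-half (k₂ - (+ 1 + k₃)) (subst (+ 0 ≤_) (eq₃ a b c)
      (0≤+ 0≤k₁-k₄ (0≤+ 0≤-4-a (ℤ.+≤+ {n = 2} ℕ.z≤n))))))
  ; 0≤k₃  = 0≤k₃
  ; 0≤k₄  = subst (+ 0 ≤_) (eq₅ a b c)
      (0≤+ (ℤ.+≤+ {n = 2} ℕ.z≤n) (0≤+ (0≤+ 0≤k₁-k₂ 0≤k₁-k₂) (0≤+ 0≤k₃ 0≤k₃)))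
  ; k₄≤k₁ = ≤-from refl 0≤k₁-k₄
  }
  where
  eq₁ : ∀ a → - (a + + 2) - + 2 ≡ - (+ 4) - a
  eq₁ = solve-∀
  eq₂ : ∀ a b → + 2 * b - (+ 2 - + 2 * a) ≡
    (- (a + + 2) - - (b + (a + a) + + 1)) + (- (a + + 2) - - (b + (a + a) + + 1))
  eq₂ = solve-∀
  eq₃ : ∀ a b c → (- (a + + 2) - - (b + (c + c) + b)) + ((- (+ 4) - a) + + 2) ≡
    (- (b + (a + a) + + 1) - (+ 1 + - (a + (b + b) + c)))
      + (- (b + (a + a) + + 1) - (+ 1 + - (a + (b + b) + c)))
  eq₃ = solve-∀
  eq₄ : ∀ a b c → - (+ 2) * a - + 4 * b - + 2 * c ≡ - (a + (b + b) + c) + - (a + (b + b) + c)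
  eq₄ = solve-∀
  eq₅ : ∀ a b c →
    + 2 + (((- (a + + 2) - - (b + (a + a) + + 1)) + (- (a + + 2) - - (b + (a + a) + + 1)))
      + (- (a + (b + b) + c) + - (a + (b + b) + c))) ≡ - (b + (c + c) + b)
  eq₅ = solve-∀
  eq₆ : ∀ a b c → + 2 * c - (a - + 2 * b + + 2) ≡ - (a + + 2) - - (b + (c + c) + b)
  eq₆ = solve-∀

  0≤-4-a : + 0 ≤ - (+ 4) - a
  0≤-4-a = ℤₚ.i≤j⇒0≤j-i a≤-4

  0≤k₁-k₂ : + 0 ≤ k₁ - k₂
  0≤k₁-k₂ = 0≤-half (k₁ - k₂) (subst (+ 0 ≤_) (eq₂ a b) (ℤₚ.i≤j⇒0≤j-i 2-2a≤2b))

  0≤k₃ : + 0 ≤ k₃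
  0≤k₃ = 0≤-half k₃ (subst (+ 0 ≤_) (eq₄ a b c) (ℤₚ.i≤j⇒0≤j-i 2c≤high))

  0≤k₁-k₄ : + 0 ≤ k₁ - k₄
  0≤k₁-k₄ = subst (+ 0 ≤_) (eq₆ a b c) (ℤₚ.i≤j⇒0≤j-i low≤2c)

-- r₈ − r₁ = P₈(β) − P₁(β) = (β + 1)² P(β) = 0.

module _ {β : ℝ} {a b c : ℤ} (d : ℕ → ℤ) (digits-d : Digits a b c (d 1) (d 2) (d 3) (d 4))
         (d₅≡ : d 5 ≡ d 3) (d₆≡ : d 6 ≡ d 2) (d₇≡ : d 7 ≡ d 1 - + 1) (d₈≡ : d 8 ≡ d 1 - + 1) where
  private
    open Digits digits-d

    ι-neg-+ : ∀ x y → ι (- (x + y)) ≡ ℚ.- (ι x ℚ.+ ι y)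
    ι-neg-+ x y = trans (ι-neg (x + y)) (cong ℚ.-_ (ι-+ x y))

    ι-neg-+₃ : ∀ x y z → ι (- (x + (y + y) + z)) ≡ ℚ.- (ι x ℚ.+ (ι y ℚ.+ ι y) ℚ.+ ι z)
    ι-neg-+₃ x y z = trans (ι-neg-+ (x + (y + y)) z)
      (cong (λ u → ℚ.- (u ℚ.+ ι z)) (trans (ι-+ x (y + y)) (cong (ι x ℚ.+_) (ι-+ y y))))

    ι-d₁ : ι (d 1) ≡ ℚ.- (ι a ℚ.+ ι (+ 2))
    ι-d₁ = trans (cong ι k₁≡) (ι-neg-+ a (+ 2))

    ι-d₂ : ι (d 2) ≡ ℚ.- (ι b ℚ.+ (ι a ℚ.+ ι a) ℚ.+ ι (+ 1))
    ι-d₂ = trans (cong ι k₂≡) (ι-neg-+₃ b a (+ 1))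

    ι-d₃ : ι (d 3) ≡ ℚ.- (ι a ℚ.+ (ι b ℚ.+ ι b) ℚ.+ ι c)
    ι-d₃ = trans (cong ι k₃≡) (ι-neg-+₃ a b c)

    ι-d₄ : ι (d 4) ≡ ℚ.- (ι b ℚ.+ (ι c ℚ.+ ι c) ℚ.+ ι b)
    ι-d₄ = trans (cong ι k₄≡) (ι-neg-+₃ b c b)

    ι-d₁-1 : ι (d 1 - + 1) ≡ ℚ.- (ι a ℚ.+ ι (+ 2)) ℚ.- ι (+ 1)
    ι-d₁-1 = trans (ι-+ (d 1) (- (+ 1))) (cong (ℚ._- ι (+ 1)) ι-d₁)

    -- The identity (x + 1)² P = P₈ - P₁ in the nested form produced by `eval` and `orbit`. The
    -- subtracted multiple of 0 is the other side of the congruence that multiplies P(β) ≈ 0 by (β +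
    -- 1)².
    identity : ∀ x A B C {K₁ K₂ K₃ K₄ K₅ K₆ K₇ K₈} →
      K₁ ≡ ℚ.- (A ℚ.+ ι (+ 2)) →
      K₂ ≡ ℚ.- (B ℚ.+ (A ℚ.+ A) ℚ.+ ι (+ 1)) →
      K₃ ≡ ℚ.- (A ℚ.+ (B ℚ.+ B) ℚ.+ C) →
      K₄ ≡ ℚ.- (B ℚ.+ (C ℚ.+ C) ℚ.+ B) →
      K₅ ≡ ℚ.- (A ℚ.+ (B ℚ.+ B) ℚ.+ C) →
      K₆ ≡ ℚ.- (B ℚ.+ (A ℚ.+ A) ℚ.+ ι (+ 1)) →
      K₇ ≡ ℚ.- (A ℚ.+ ι (+ 2)) ℚ.- ι (+ 1) →
      K₈ ≡ ℚ.- (A ℚ.+ ι (+ 2)) ℚ.- ι (+ 1) →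
      (x ℚ.+ 1ℚ) ℚ.* (x ℚ.+ 1ℚ) ℚ.* (ι (+ 1) ℚ.+ x ℚ.* (A ℚ.+ x ℚ.* (B ℚ.+ x ℚ.* (C ℚ.+ x ℚ.*
        (B ℚ.+ x ℚ.* (A ℚ.+ x ℚ.* (ι (+ 1) ℚ.+ x ℚ.* 0ℚ)))))))
        ℚ.- (x ℚ.+ 1ℚ) ℚ.* (x ℚ.+ 1ℚ) ℚ.* 0ℚ
      ≡ (x ℚ.* (x ℚ.* (x ℚ.* (x ℚ.* (x ℚ.* (x ℚ.* (x ℚ.* (x ℚ.* 1ℚ ℚ.- K₁) ℚ.- K₂) ℚ.- K₃) ℚ.- K₄)
        ℚ.- K₅) ℚ.- K₆) ℚ.- K₇) ℚ.- K₈) ℚ.- (x ℚ.* 1ℚ ℚ.- K₁)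
    identity x A B C refl refl refl refl refl refl refl refl = solve 4 (λ x A B C →
      let 𝟙 = con 1ℚ ; k₁ = :- (A :+ con (ι (+ 2))) ; k₂ = :- (B :+ (A :+ A) :+ 𝟙)
          k₃ = :- (A :+ (B :+ B) :+ C) ; k₄ = :- (B :+ (C :+ C) :+ B) ; k₇ = k₁ :- 𝟙 in
      (x :+ 𝟙) :* (x :+ 𝟙) :* (𝟙 :+ x :* (A :+ x :* (B :+ x :* (C :+ x :*
        (B :+ x :* (A :+ x :* (𝟙 :+ x :* con 0ℚ)))))))
        :- (x :+ 𝟙) :* (x :+ 𝟙) :* con 0ℚ
      := (x :* (x :* (x :* (x :* (x :* (x :* (x :* (x :* 𝟙 :- k₁) :- k₂) :- k₃) :- k₄)
        :- k₃) :- k₂) :- k₇) :- k₇) :- (x :* 𝟙 :- k₁)) refl x A B C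

    orbit-difference : ∀ n →
      seq ((β +ℝ 1ℝ) *ℝ (β +ℝ 1ℝ) *ℝ evalℝ (ℤ→ℚ[x] (sextic a b c)) β) n
        ℚ.- seq ((β +ℝ 1ℝ) *ℝ (β +ℝ 1ℝ) *ℝ 0ℝ) n
      ≡ seq (orbit β d 8) n ℚ.- seq (orbit β d 1) n
    orbit-difference n = identity (seq β n) (ι a) (ι b) (ι c)
      {ι (d 1)} {ι (d 2)} {ι (d 3)} {ι (d 4)} {ι (d 5)} {ι (d 6)} {ι (d 7)} {ι (d 8)}
      ι-d₁ ι-d₂ ι-d₃ ι-d₄ (trans (cong ι d₅≡) ι-d₃) (trans (cong ι d₆≡) ι-d₂)
      (trans (cong ι d₇≡) ι-d₁-1) (trans (cong ι d₈≡) ι-d₁-1)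

  orbit-closed : evalℝ (ℤ→ℚ[x] (sextic a b c)) β ≈ℝ 0ℝ → orbit β d 8 ≈ℝ orbit β d 1
  orbit-closed P≈0 ε 0<ε =
    let N , h = *-congˡ ((β +ℝ 1ℝ) *ℝ (β +ℝ 1ℝ)) {evalℝ (ℤ→ℚ[x] (sextic a b c)) β} {0ℝ} P≈0 ε 0<ε
    in N , λ n N≤n → subst (λ t → ∣ t ∣ ℚ.≤ ε) (orbit-difference n) (h n N≤n)

proposition2p5 : (β : ℝ) (a b c : ℤ) → IsSalem β →
    IsMinimalPolynomial β (ℤ→ℚ[x] (+ 1 ∷ a ∷ b ∷ c ∷ b ∷ a ∷ + 1 ∷ [])) →
    β ∈ 𝒫 1 7 ∩ 𝒞 (+ 1 ∷ + 2 ∷ + 1 ∷ []) ⇔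
    (a ≤ - (+ 4)
    × (+ 2 - + 2 * a ≤ + 2 * b × + 2 * b ≤ - (+ 3) * a - + 2)
    × (a - + 2 * b + + 2 ≤ + 2 * c × + 2 * c ≤ - (+ 2) * a - + 4 * b))
proposition2p5 β a b c salem minimal = mk⇔ necessary sufficient
  where
  1<β : 1ℝ <ℝ β
  1<β = IsSalem.1<β salem

  necessary : β ∈ 𝒫 1 7 ∩ 𝒞 Q → Conditions a b c
  necessary ((_ , _ , H) , (_ , m , p , d , H′ , μ , μ-minimal , companion≈))
    with refl , refl ← preperiod-period-unique H′ H
    = digits⇒conditions (companion⇒digits a b c d μ companion≈ μ≈)
        (digit≤first 0) (0≤digit 2) (digit≤first 2)
    where
    open DigitBounds 1<β (HasPreperiodPeriod.expansion H′)

    -- Uniqueness holds over ℚ and returns to integer coefficients by injectivity of `ι`.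
    μ≈ : μ ℤ[x].≈ₚ sextic a b c
    μ≈ n = ι-injective (trans (sym (coeff-ι μ n))
      (trans
        (minimalPolynomial-unique {β} {ℤ→ℚ[x] μ} {ℤ→ℚ[x] (sextic a b c)} μ-minimal minimal n)
        (coeff-ι (sextic a b c) n)))

  sufficient : Conditions a b c → β ∈ 𝒫 1 7 ∩ 𝒞 Q
  sufficient conditions =
    (salem , _ , H) , (salem , 1 , 7 , _ , H , sextic a b c , minimal , digits⇒companion ds)
    where
    ds : Digits a b c _ _ _ _
    -- The defining formulas themselves are taken as digits, which determines all the placeholders.
    ds = mkDigits refl refl refl refl

    open Admissible (conditions⇒admissible ds conditions)

    H = DigitExpansion.hasPreperiodPeriod β 1<β _ _ _ _ 2≤k₁ k₂≤k₁ k₃<k₂ 0≤k₃ 0≤k₄ k₄≤k₁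
      (orbit-closed {β} (digits _ _ _ _) ds refl refl refl refl (proj₁ (proj₂ (proj₂ minimal))))
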